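{- Let $L$ be a metric signature and let $T$ be a complete continuous $L$-theory. The following are equivalent: (i) $T\models\mathrm{SCP}$; (ii) $T$ is preserved under reduced products; (iii) $T$ is preserved under $\mathrm{Fin}^\ast$-products, meaning that any reduced product of models of $T$ by $\mathrm{Fin}^\ast$ is also a model of $T$.
   Context: Continuous first-order logic. The domains of (metric) $L$-structures are nonempty complete bounded metric spaces; predicates are bounded uniformly continuous real-valued maps, with bounds and moduli of uniform continuity prescribed by the signature. Formulas are built from atomic formulas (predicates, including the metric $d$, applied to terms) using continuous connectives $\mathbb R^n\to\mathbb R$ and the quantifiers $\sup,\inf$; formulas are $\mathbb R$-valued. A unary connective is a continuous map $\mathbb R\to\mathbb R$. A theory is a set of conditions such as $\varphi\le r$, with $\varphi$ a sentence and $r\in\mathbb R$; it is complete if it is consistent and any two of its models give the same value to every sentence. All filters are proper filters on nonempty sets; $\mathrm{Fin}^\ast$ is the Fréchet filter on $\omega$ (cofinite subsets). For a bounded family of reals, $\limsup_{i\to F}u_i=\inf_{J\in F}\sup_{i\in J}u_i$. Reduced products: on $\prod_i M_i$ let $d_F(a,b)=\limsup_{i\to F}d^{M_i}(a_i,b_i)$. The reduced product $M_F=\prod_i M_i/F$ has as domain the quotient of $\prod_iM_i$ by $d_F(a,b)=0$ (a complete bounded metric space); $a_F$ denotes the image of $a$; constants and functions are interpreted coordinatewise, and $p^{M_F}(a_F)=\limsup_{i\to F}p^{M_i}(a_i)$ for predicate symbols $p$. $T$ is preserved under reduced products if for every family $(M_i)_{i\in I}$ and filter $F$ on $I$ with $\{i:M_i\models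 T\}\in F$, we have $M_F\models T$. Palyutin formulas: the smallest set of formulas such that (1) every atomic formula is Palyutin; (2) if $\varphi$ is Palyutin and $C$ is a nondecreasing unary connective, then $C\varphi$ is Palyutin; (3) if $\varphi,\psi$ are Palyutin, so is $\max(\varphi,\psi)$; (4) if $\varphi$ is Palyutin and $x$ is a variable, $\inf_x\varphi$ and $\sup_x\varphi$ are Palyutin; (5) if $\varphi,\psi$ are Palyutin, $D$ is a nonincreasing unary connective with (necessarily unique) fixed point $\Delta$, and $x$ is a variable, then $\max(\inf_x\varphi,\ \sup_x\min(D\varphi,\Delta,\psi))$ is Palyutin. $\mathrm{SCP}$ is the theory consisting of the conditions \[\sup_y\Big(\inf_x\max(\varphi,D_1\psi_1,\dots,D_n\psi_n)-\max_{1\le j\le n}\inf_x\max(\varphi,D_j\psi_j)\Big)\le 0\] for all $n\ge2$, all Palyutin formulas $\varphi(x,y),\psi_1(x,y),\dots,\psi_n(x,y)$ ($x,y$ tuples of variables) and all nonincreasing unary connectives $D_1,\dots,D_n$. -}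

module Defs where

open import Axiom.ExcludedMiddle using (ExcludedMiddle)
open import Data.Bool.Base using (Bool; T)
open import Data.Empty using (⊥-elim)
open import Data.Fin.Base using (Fin; zero; suc)
open import Data.Integer.Base as ℤ using ()
import Data.Integer.Properties as ℤ
open import Data.Nat.Base as ℕ using (ℕ; zero; suc)
import Data.Nat.Properties as ℕ
open import Data.Product using (Σ; ∃; _×_; _,_; proj₁; proj₂)
open import Data.Rational as ℚ using (ℚ; 0ℚ; 1ℚ; ½)
import Data.Rational.Properties as ℚ
import Data.Rational.Unnormalised.Base as ℚᵘ
import Data.Rational.Unnormalised.Properties as ℚᵘ
open import Data.Rational.Solver using (module +-*-Solver)
open import Data.Sum using (_⊎_; inj₁; inj₂)
open import Data.Unit.Polymorphic using (⊤; tt)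
open import Data.Vec.Functional using (Vector; []; _∷_; head; tail)
open import Function.Base using (_∘_)
open import Function.Metric.Structures using (IsGeneralMetric)
open import Level using (Level; Lift; lift; 0ℓ) renaming (suc to lsuc)
open import Relation.Binary.Core using (Rel)
open import Relation.Binary.Structures using (IsPartialOrder)
open import Relation.Binary.PropositionalEquality using (_≡_; refl; sym; trans; cong; subst)
open import Relation.Nullary using (¬_; yes; no)
open import Relation.Nullary.Decidable using (isYes; toWitness; fromWitness)
open import Relation.Unary using (Pred; _∈_; _⊆_; _∩_; Satisfiable)

module ℚ-Lemmas where
  +-minus : ∀ p q → p ℚ.+ (q ℚ.- p) ≡ q
  +-minus = solve 2 (λ p q → p :+ (q :- p) := q) refl
    where open +-*-Solver

  minus-+ : ∀ p q → (q ℚ.- p) ℚ.+ p ≡ q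
  minus-+ = solve 2 (λ p q → (q :- p) :+ p := q) refl
    where open +-*-Solver

  neg-neg : ∀ p → ℚ.- (ℚ.- p) ≡ p
  neg-neg = solve 1 (λ p → :- (:- p) := p) refl
    where open +-*-Solver

  minus-pos : ∀ {p q} → p ℚ.< q → 0ℚ ℚ.< q ℚ.- p
  minus-pos {p} {q} p<q =
    subst (ℚ._< q ℚ.- p) (ℚ.+-inverseʳ p) (ℚ.+-monoˡ-< (ℚ.- p) p<q)

  pos-+ : ∀ p {ε} → 0ℚ ℚ.< ε → p ℚ.< p ℚ.+ ε
  pos-+ p {ε} 0<ε = subst (ℚ._< p ℚ.+ ε) (ℚ.+-identityʳ p) (ℚ.+-monoʳ-< p 0<ε)

  neg-+ : ∀ p {ε} → ε ℚ.< 0ℚ → p ℚ.+ ε ℚ.< p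
  neg-+ p {ε} ε<0 = subst (p ℚ.+ ε ℚ.<_) (ℚ.+-identityʳ p) (ℚ.+-monoʳ-< p ε<0)

  ⊓-glb-< : ∀ {p a b} → p ℚ.< a → p ℚ.< b → p ℚ.< a ℚ.⊓ b
  ⊓-glb-< {p} {a} {b} p<a p<b with ℚ.⊓-sel a b
  ... | inj₁ eq = subst (p ℚ.<_) (sym eq) p<a
  ... | inj₂ eq = subst (p ℚ.<_) (sym eq) p<b

  _·_ : ℕ → ℚ → ℚ
  zero  · p = 0ℚ
  suc n · p = p ℚ.+ n · p

  ·-mono : ∀ n {p q} → p ℚ.≤ q → n · p ℚ.≤ n · q
  ·-mono zero    p≤q = ℚ.≤-refl
  ·-mono (suc n) p≤q = ℚ.+-mono-≤ p≤q (·-mono n p≤q)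

  ·-nonneg : ∀ n {p} → 0ℚ ℚ.≤ p → 0ℚ ℚ.≤ n · p
  ·-nonneg zero    0≤p = ℚ.≤-refl
  ·-nonneg (suc n) 0≤p = ℚ.+-mono-≤ 0≤p (·-nonneg n 0≤p)

  ·-+ : ∀ n p q → n · (p ℚ.+ q) ≡ n · p ℚ.+ n · q
  ·-+ zero    p q = refl
  ·-+ (suc n) p q = trans (cong ((p ℚ.+ q) ℚ.+_) (·-+ n p q))
    (solve 4 (λ p q a b → (p :+ q) :+ (a :+ b) := (p :+ a) :+ (q :+ b)) refl p q (n · p) (n · q))
    where open +-*-Solver

  ·-* : ∀ n p q → n · p ℚ.* q ≡ n · (p ℚ.* q)
  ·-* zero    p q = ℚ.*-zeroˡ q
  ·-* (suc n) p q = trans (ℚ.*-distribʳ-+ q p (n · p)) (cong (p ℚ.* q ℚ.+_) (·-* n p q))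

  ·1-toℚᵘ : ∀ n → ℚ.toℚᵘ (n · 1ℚ) ℚᵘ.≃ ℚᵘ.mkℚᵘ (ℤ.+ n) 0
  ·1-toℚᵘ zero    = ℚᵘ.≃-refl
  ·1-toℚᵘ (suc n) = ℚᵘ.≃-trans (ℚ.toℚᵘ-homo-+ 1ℚ (n · 1ℚ))
    (ℚᵘ.≃-trans (ℚᵘ.+-congʳ ℚᵘ.1ℚᵘ (·1-toℚᵘ n))
      (ℚᵘ.*≡* (cong (λ z → (ℤ.+ 1 ℤ.+ z) ℤ.* ℤ.+ 1) (ℤ.*-identityʳ (ℤ.+ n)))))

  ≤-·1 : ∀ p → ∃ λ n → p ℚ.≤ n · 1ℚ
  ≤-·1 p = ℤ.∣ ℚ.↥ p ∣ , ℚ.toℚᵘ-cancel-≤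
    (ℚᵘ.≤-respʳ-≃ (ℚᵘ.≃-sym (·1-toℚᵘ ℤ.∣ ℚ.↥ p ∣)) (bound p))
    where
    i≤∣i∣*d : ∀ i d → i ℤ.* ℤ.+ 1 ℤ.≤ ℤ.+ ℤ.∣ i ∣ ℤ.* ℤ.+ suc d
    i≤∣i∣*d (ℤ.+ n) d = subst (ℤ._≤ ℤ.+ n ℤ.* ℤ.+ suc d) refl
      (ℤ.*-monoˡ-≤-nonNeg (ℤ.+ n) {ℤ.+ 1} {ℤ.+ suc d} (ℤ.+≤+ (ℕ.s≤s ℕ.z≤n)))
    i≤∣i∣*d ℤ.-[1+ n ] d = ℤ.-≤+
    bound : ∀ p → ℚ.toℚᵘ p ℚᵘ.≤ ℚᵘ.mkℚᵘ (ℤ.+ ℤ.∣ ℚ.↥ p ∣) 0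
    bound (ℚ.mkℚ i d _) = ℚᵘ.*≤* (i≤∣i∣*d i d)

  archimedean : ∀ {ε} → 0ℚ ℚ.< ε → ∀ b → ∃ λ n → b ℚ.≤ n · ε
  archimedean {ε} 0<ε b = n , subst (ℚ._≤ n · ε) b/ε*ε≡b
    (subst (b/ε ℚ.* ε ℚ.≤_) (trans (·-* n 1ℚ ε) (cong (n ·_) (ℚ.*-identityˡ ε)))
      (ℚ.*-monoʳ-≤-nonNeg ε (proj₂ (≤-·1 b/ε))))
    where
    instance
      ε-positive : ℚ.Positive ε
      ε-positive = ℚ.positive 0<ε
      ε-nonNegative : ℚ.NonNegative ε
      ε-nonNegative = ℚ.pos⇒nonNeg ε
      ε-nonZero : ℚ.NonZero ε
      ε-nonZero = ℚ.pos⇒nonZero ε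
    b/ε = b ℚ.* (ℚ.1/ ε)
    n = proj₁ (≤-·1 b/ε)
    b/ε*ε≡b : b/ε ℚ.* ε ≡ b
    b/ε*ε≡b = trans (ℚ.*-assoc b (ℚ.1/ ε) ε)
      (trans (cong (b ℚ.*_) (ℚ.*-inverseˡ ε)) (ℚ.*-identityʳ b))

  ½^ : ℕ → ℚ
  ½^ zero    = 1ℚ
  ½^ (suc n) = ½ ℚ.* ½^ n

  ½^-double : ∀ n → ½^ (suc n) ℚ.+ ½^ (suc n) ≡ ½^ n
  ½^-double n = trans (sym (ℚ.*-distribʳ-+ (½^ n) ½ ½)) (ℚ.*-identityˡ (½^ n))

  ½^-pos : ∀ n → 0ℚ ℚ.< ½^ n
  ½^-pos zero    = ℚ.positive⁻¹ 1ℚ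
  ½^-pos (suc n) = subst (ℚ._< ½^ (suc n)) (ℚ.*-zeroʳ ½) (ℚ.*-monoʳ-<-pos ½ (½^-pos n))

  ·-½^ : ∀ n → suc n · ½^ n ℚ.≤ 1ℚ
  ·-½^ zero    = ℚ.≤-refl
  ·-½^ (suc n) = ℚ.≤-trans
    (ℚ.+-monoˡ-≤ (suc n · e) (subst (ℚ._≤ suc n · e) (ℚ.+-identityʳ e)
      (ℚ.+-monoʳ-≤ e (·-nonneg n (ℚ.<⇒≤ (½^-pos (suc n)))))))
    (subst (ℚ._≤ 1ℚ) (trans (cong (suc n ·_) (sym (½^-double n))) (·-+ (suc n) e e)) (·-½^ n))
    where e = ½^ (suc n)

  ½^-small : ∀ {ε} → 0ℚ ℚ.< ε → ∃ λ n → ½^ n ℚ.≤ ε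
  ½^-small {ε} 0<ε with archimedean 0<ε 1ℚ
  ... | n , 1≤nε with ½^ n ℚ.≤? ε
  ...   | yes p = n , p
  ...   | no ¬p = ⊥-elim (ℚ.<-irrefl refl
          (ℚ.<-≤-trans (subst (ℚ._< suc n · ½^ n) (ℚ.+-identityˡ _) (ℚ.+-monoˡ-< (n · ½^ n) (½^-pos n)))
            (ℚ.≤-trans (·-½^ n) (ℚ.≤-trans 1≤nε (·-mono n (ℚ.<⇒≤ (ℚ.≰⇒> ¬p)))))))

open ℚ-Lemmas

-- Excluded middle in this form, for types rather than truth values, also yields
-- the axiom of choice.
module Classical (em : ∀ {ℓ} → ExcludedMiddle ℓ) where

  private
    variable
      ℓ : Level

  by-contradiction : {P : Set ℓ} → ¬ ¬ P → P
  by-contradiction {P = P} ¬¬p with em {P = P}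
  ... | yes p = p
  ... | no ¬p = ⊥-elim (¬¬p ¬p)

  infix  4 _◂_ _≤_ _<_ _≈_
  infixl 6 _+_

  -- Dedekind reals: x is given by its lower cut { q | q < x }.  Deciding the
  -- cut by a Bool, which excluded middle allows, keeps ℝ in the lowest universe.
  record ℝ : Set where
    no-eta-equality
    field
      below     : ℚ → Bool
      inhabited : ∃ λ q → T (below q)
      bounded   : ∃ λ q → ¬ T (below q)
      closed    : ∀ {p q} → p ℚ.< q → T (below q) → T (below p)
      open′     : ∀ {p} → T (below p) → ∃ λ q → p ℚ.< q × T (below q)

  -- q ◂ x means q < x.
  record _◂_ (q : ℚ) (x : ℝ) : Set where
    constructor mk
    field holds : T (ℝ.below x q)

  record _≤_ (x y : ℝ) : Set where
    constructor mk
    field on : ∀ {q} → q ◂ x → q ◂ y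

  open _≤_ using (on)

  _≈_ : Rel ℝ 0ℓ
  x ≈ y = x ≤ y × y ≤ x

  _<_ : Rel ℝ 0ℓ
  x < y = ¬ (y ≤ x)

  module Cut-Lemmas where
    ∃-below : ∀ x → ∃ (_◂ x)
    ∃-below x with ℝ.inhabited x
    ... | q , p = q , mk p

    ∃-above : ∀ x → ∃ λ q → ¬ q ◂ x
    ∃-above x with ℝ.bounded x
    ... | q , p = q , λ (mk r) → p r

    ◂-closed : ∀ {x p q} → p ℚ.< q → q ◂ x → p ◂ x
    ◂-closed {x} p<q (mk r) = mk (ℝ.closed x p<q r)

    ◂-closed-≤ : ∀ {x p q} → p ℚ.≤ q → q ◂ x → p ◂ x
    ◂-closed-≤ {x} {p} {q} p≤q q◂x with p ℚ.<? q
    ... | yes p<q = ◂-closed p<q q◂x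
    ... | no p≮q  = subst (_◂ x) (ℚ.≤-antisym (ℚ.≮⇒≥ p≮q) p≤q) q◂x

    up : ∀ {x p} → p ◂ x → ∃ λ q → p ℚ.< q × q ◂ x
    up {x} (mk r) with ℝ.open′ x r
    ... | q , p<q , r′ = q , p<q , mk r′

    below-bound : ∀ {x p q} → p ◂ x → ¬ q ◂ x → p ℚ.< q
    below-bound {x} p◂x ¬q◂x = ℚ.≰⇒> (λ q≤p → ¬q◂x (◂-closed-≤ q≤p p◂x))

  open Cut-Lemmas

  record IsCut (P : ℚ → Set ℓ) : Set ℓ where
    field
      inhabited : ∃ P
      bounded   : ∃ λ q → ¬ P q
      closed    : ∀ {p q} → p ℚ.< q → P q → P p
      open′     : ∀ {p} → P p → ∃ λ q → p ℚ.< q × P q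

  module _ {P : ℚ → Set ℓ} where

    cut : IsCut P → ℝ
    cut isCut = record
      { below     = λ q → isYes (em {P = P q})
      ; inhabited = proj₁ inhabited , fromWitness (proj₂ inhabited)
      ; bounded   = proj₁ bounded , λ t → proj₂ bounded (toWitness t)
      ; closed    = λ p<q t → fromWitness (closed p<q (toWitness t))
      ; open′     = λ t → let (q , p<q , Pq) = open′ (toWitness t) in q , p<q , fromWitness Pq
      }
      where open IsCut isCut

    cut-intro : ∀ (c : IsCut P) {q} → P q → q ◂ cut c
    cut-intro _ p = mk (fromWitness p)

    cut-elim : ∀ (c : IsCut P) {q} → q ◂ cut c → P q
    cut-elim _ (mk t) = toWitness t

  SumCut MaxCut MinCut : ℝ → ℝ → ℚ → Set
  SumCut x y q = ∃ λ r → ∃ λ s → r ◂ x × s ◂ y × q ℚ.< r ℚ.+ s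
  MaxCut x y q = q ◂ x ⊎ q ◂ y
  MinCut x y q = q ◂ x × q ◂ y

  NegationCut : ℝ → ℚ → Set
  NegationCut x q = ∃ λ r → q ℚ.< r × ¬ (ℚ.- r ◂ x)

  SupCut : {I : Set ℓ} → (I → ℝ) → ℚ → Set ℓ
  SupCut f q = ∃ λ i → q ◂ f i

  module Cuts where

    rational : ∀ r → IsCut (ℚ._< r)
    rational r = record
      { inhabited = r ℚ.- 1ℚ , neg-+ r (ℚ.negative⁻¹ (ℚ.- 1ℚ))
      ; bounded   = r , ℚ.<-irrefl refl
      ; closed    = ℚ.<-trans
      ; open′     = ℚ.<-dense
      }

    sum : ∀ x y → IsCut (SumCut x y)
    sum x y = record
      { inhabited =
          let (r , r◂x) = ∃-below x
              (s , s◂y) = ∃-below y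
              (r′ , r<r′ , r′◂x) = up r◂x
          in r ℚ.+ s , r′ , s , r′◂x , s◂y , ℚ.+-monoˡ-< s r<r′
      ; bounded =
          let (a , ¬a◂x) = ∃-above x
              (b , ¬b◂y) = ∃-above y
          in a ℚ.+ b , λ (r , s , r◂x , s◂y , a+b<r+s) →
               ℚ.<-irrefl refl (ℚ.<-trans a+b<r+s
                 (ℚ.+-mono-< (below-bound r◂x ¬a◂x) (below-bound s◂y ¬b◂y)))
      ; closed = λ p<q (r , s , r◂x , s◂y , q<r+s) → r , s , r◂x , s◂y , ℚ.<-trans p<q q<r+s
      ; open′ = λ (r , s , r◂x , s◂y , p<r+s) →
          let (q , p<q , q<r+s) = ℚ.<-dense p<r+s in q , p<q , r , s , r◂x , s◂y , q<r+s
      }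

    negation : ∀ x → IsCut (NegationCut x)
    negation x = record
      { inhabited =
          let (b , ¬b◂x) = ∃-above x
          in ℚ.- b ℚ.- 1ℚ , ℚ.- b , neg-+ (ℚ.- b) (ℚ.negative⁻¹ (ℚ.- 1ℚ))
           , subst (λ q → ¬ q ◂ x) (sym (neg-neg b)) ¬b◂x
      ; bounded =
          let (a , a◂x) = ∃-below x
          in ℚ.- a , λ (r , -a<r , ¬-r◂x) →
               ¬-r◂x (◂-closed (subst (ℚ.- r ℚ.<_) (neg-neg a) (ℚ.neg-antimono-< -a<r)) a◂x)
      ; closed = λ p<q (r , q<r , ¬r) → r , ℚ.<-trans p<q q<r , ¬r
      ; open′ = λ (r , p<r , ¬r) → let (q , p<q , q<r) = ℚ.<-dense p<r in q , p<q , r , q<r , ¬r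
      }

    maximum : ∀ x y → IsCut (MaxCut x y)
    maximum x y = record
      { inhabited = let (q , q◂x) = ∃-below x in q , inj₁ q◂x
      ; bounded =
          let (a , ¬a◂x) = ∃-above x
              (b , ¬b◂y) = ∃-above y
          in a ℚ.⊔ b , λ { (inj₁ p) → ¬a◂x (◂-closed-≤ (ℚ.p≤p⊔q a b) p)
                         ; (inj₂ p) → ¬b◂y (◂-closed-≤ (ℚ.p≤q⊔p a b) p) }
      ; closed = λ { p<q (inj₁ p) → inj₁ (◂-closed p<q p) ; p<q (inj₂ p) → inj₂ (◂-closed p<q p) }
      ; open′ = λ { (inj₁ p) → let (q , p<q , r) = up p in q , p<q , inj₁ r
                  ; (inj₂ p) → let (q , p<q , r) = up p in q , p<q , inj₂ r }
      }

    minimum : ∀ x y → IsCut (MinCut x y)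
    minimum x y = record
      { inhabited =
          let (a , a◂x) = ∃-below x
              (b , b◂y) = ∃-below y
          in a ℚ.⊓ b , ◂-closed-≤ (ℚ.p⊓q≤p a b) a◂x , ◂-closed-≤ (ℚ.p⊓q≤q a b) b◂y
      ; bounded = let (a , ¬a◂x) = ∃-above x in a , λ (a◂x , _) → ¬a◂x a◂x
      ; closed = λ p<q (q◂x , q◂y) → ◂-closed p<q q◂x , ◂-closed p<q q◂y
      ; open′ = λ (p◂x , p◂y) →
          let (a , p<a , a◂x) = up p◂x
              (b , p<b , b◂y) = up p◂y
          in a ℚ.⊓ b , ⊓-glb-< p<a p<b
           , ◂-closed-≤ (ℚ.p⊓q≤p a b) a◂x , ◂-closed-≤ (ℚ.p⊓q≤q a b) b◂y
      }

    supremum : {I : Set ℓ} (f : I → ℝ) → I → (∃ λ b → ∀ i → f i ≤ b) → IsCut (SupCut f)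
    supremum f i₀ (b , f≤b) = record
      { inhabited = let (q , p) = ∃-below (f i₀) in q , i₀ , p
      ; bounded = let (q , ¬q◂b) = ∃-above b in q , λ (i , q◂fi) → ¬q◂b (on (f≤b i) q◂fi)
      ; closed = λ p<q (i , q◂fi) → i , ◂-closed p<q q◂fi
      ; open′ = λ (i , p◂fi) → let (q , p<q , q◂fi) = up p◂fi in q , p<q , i , q◂fi
      }

  -- Opaque only so that typechecking does not unfold the cuts; the -intro and
  -- -elim functions give their members.
  opaque
    fromℚ : ℚ → ℝ
    fromℚ r = cut (Cuts.rational r)

    fromℚ-intro : ∀ r {q} → q ℚ.< r → q ◂ fromℚ r
    fromℚ-intro r = cut-intro (Cuts.rational r)

    fromℚ-elim : ∀ r {q} → q ◂ fromℚ r → q ℚ.< r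
    fromℚ-elim r = cut-elim (Cuts.rational r)

    _+_ : ℝ → ℝ → ℝ
    x + y = cut (Cuts.sum x y)

    +-intro : ∀ x y {q} → SumCut x y q → q ◂ x + y
    +-intro x y = cut-intro (Cuts.sum x y)

    +-elim : ∀ x y {q} → q ◂ x + y → SumCut x y q
    +-elim x y = cut-elim (Cuts.sum x y)

    -_ : ℝ → ℝ
    - x = cut (Cuts.negation x)

    neg-intro : ∀ x {q} → NegationCut x q → q ◂ - x
    neg-intro x = cut-intro (Cuts.negation x)

    neg-elim : ∀ x {q} → q ◂ - x → NegationCut x q
    neg-elim x = cut-elim (Cuts.negation x)

    max : ℝ → ℝ → ℝ
    max x y = cut (Cuts.maximum x y)

    max-intro : ∀ x y {q} → MaxCut x y q → q ◂ max x y
    max-intro x y = cut-intro (Cuts.maximum x y)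

    max-elim : ∀ x y {q} → q ◂ max x y → MaxCut x y q
    max-elim x y = cut-elim (Cuts.maximum x y)

    min : ℝ → ℝ → ℝ
    min x y = cut (Cuts.minimum x y)

    min-intro : ∀ x y {q} → MinCut x y q → q ◂ min x y
    min-intro x y = cut-intro (Cuts.minimum x y)

    min-elim : ∀ x y {q} → q ◂ min x y → MinCut x y q
    min-elim x y = cut-elim (Cuts.minimum x y)

  0ᵣ : ℝ
  0ᵣ = fromℚ 0ℚ

  opaque
    -- The least upper bound of a nonempty family bounded above.  Other families,
    -- which do not arise from formulas, get the junk value 0.
    sup : {I : Set ℓ} → (I → ℝ) → ℝ
    sup {I = I} f with em {P = I × ∃ λ b → ∀ i → f i ≤ b}
    ... | yes (i₀ , bdd) = cut (Cuts.supremum f i₀ bdd)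
    ... | no _           = 0ᵣ

    ≤-sup : {I : Set ℓ} {f : I → ℝ} {b : ℝ} → (∀ i → f i ≤ b) → ∀ i → f i ≤ sup f
    ≤-sup {I = I} {f} {b} f≤b i with em {P = I × ∃ λ b → ∀ i → f i ≤ b}
    ... | yes (i₀ , bdd) = mk λ p → cut-intro (Cuts.supremum f i₀ bdd) (i , p)
    ... | no ¬p          = ⊥-elim (¬p (i , b , f≤b))

    sup-≤ : {I : Set ℓ} {f : I → ℝ} → I → ∀ {c} → (∀ i → f i ≤ c) → sup f ≤ c
    sup-≤ {I = I} {f} i₁ {c} f≤c with em {P = I × ∃ λ b → ∀ i → f i ≤ b}
    ... | yes (i₀ , bdd) = mk λ p → let (i , q) = cut-elim (Cuts.supremum f i₀ bdd) p in on (f≤c i) q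
    ... | no ¬p          = ⊥-elim (¬p (i₁ , c , f≤c))

  inf : {I : Set ℓ} → (I → ℝ) → ℝ
  inf f = - sup (λ i → - f i)

  module ℝ-Lemmas where
    ≤-refl : ∀ {x} → x ≤ x
    ≤-refl = mk λ p → p

    ≤-trans : ∀ {x y z} → x ≤ y → y ≤ z → x ≤ z
    ≤-trans a b = mk λ p → on b (on a p)

    ≤-total : ∀ {x y} → ¬ (x ≤ y) → y ≤ x
    ≤-total {x} {y} x≰y = mk λ {p} p◂y → by-contradiction λ ¬p◂x →
      x≰y (mk λ q◂x → ◂-closed (below-bound q◂x ¬p◂x) p◂y)

    ≤-isPartialOrder : IsPartialOrder _≈_ _≤_
    ≤-isPartialOrder = record
      { isPreorder = record
        { isEquivalence = record
          { refl  = ≤-refl , ≤-refl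
          ; sym   = λ (a , b) → b , a
          ; trans = λ (a , b) (c , d) → ≤-trans a c , ≤-trans d b
          }
        ; reflexive = proj₁
        ; trans = ≤-trans
        }
      ; antisym = _,_
      }

    <-≤-trans : ∀ {x y z} → x < y → y ≤ z → x < z
    <-≤-trans x<y y≤z z≤x = x<y (≤-trans y≤z z≤x)

    ≤-<-trans : ∀ {x y z} → x ≤ y → y < z → x < z
    ≤-<-trans x≤y y<z z≤x = y<z (≤-trans z≤x x≤y)

    <⇒≤ : ∀ {x y} → x < y → x ≤ y
    <⇒≤ = ≤-total

    +-mono : ∀ {x x′ y y′} → x ≤ x′ → y ≤ y′ → x + y ≤ x′ + y′
    +-mono {x} {x′} {y} {y′} a b = mk λ p →
      let (r , s , r◂x , s◂y , lt) = +-elim x y p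
      in +-intro x′ y′ (r , s , on a r◂x , on b s◂y , lt)

    +-comm : ∀ x y → x + y ≤ y + x
    +-comm x y = mk λ {q} p →
      let (r , s , r◂x , s◂y , lt) = +-elim x y p
      in +-intro y x (s , r , s◂y , r◂x , subst (q ℚ.<_) (ℚ.+-comm r s) lt)

    +-assoc : ∀ x y z → (x + y) + z ≤ x + (y + z)
    +-assoc x y z = mk λ {q} p →
      let (r , s , r◂xy , s◂z , q<r+s) = +-elim (x + y) z p
          (a , b , a◂x , b◂y , r<a+b) = +-elim x y r◂xy
          (b′ , b<b′ , b′◂y) = up b◂y
      in +-intro x (y + z)
        (a , b ℚ.+ s , a◂x , +-intro y z (b′ , s , b′◂y , s◂z , ℚ.+-monoˡ-< s b<b′)
        , ℚ.<-trans q<r+s (subst (r ℚ.+ s ℚ.<_) (ℚ.+-assoc a b s) (ℚ.+-monoˡ-< s r<a+b)))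

    +-assoc⁻ : ∀ x y z → x + (y + z) ≤ (x + y) + z
    +-assoc⁻ x y z = ≤-trans (+-comm x (y + z)) (≤-trans (+-assoc y z x)
      (≤-trans (+-comm y (z + x)) (≤-trans (+-assoc z x y) (+-comm z (x + y)))))

    +-interchange : ∀ x y z w → (x + y) + (z + w) ≤ (x + z) + (y + w)
    +-interchange x y z w = ≤-trans (+-assoc x y (z + w)) (≤-trans
      (+-mono ≤-refl (≤-trans (+-assoc⁻ y z w) (≤-trans (+-mono (+-comm y z) ≤-refl) (+-assoc z y w))))
      (+-assoc⁻ x z (y + w)))

    ≤+ : ∀ x {y} → 0ᵣ ≤ y → x ≤ x + y
    ≤+ x {y} 0≤y = ≤-trans x≤x+0 (+-mono ≤-refl 0≤y)
      where
      x≤x+0 : x ≤ x + 0ᵣ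
      x≤x+0 = mk λ {q} q◂x →
        let (p , q<p , p◂x) = up q◂x
            (r , q<r , r<p) = ℚ.<-dense q<p
        in +-intro x 0ᵣ
          ( p , r ℚ.- p , p◂x
          , fromℚ-intro 0ℚ (subst (r ℚ.- p ℚ.<_) (ℚ.+-inverseʳ p) (ℚ.+-monoˡ-< (ℚ.- p) r<p))
          , subst (q ℚ.<_) (sym (+-minus p r)) q<r)

    fromℚ-mono : ∀ {p q} → p ℚ.≤ q → fromℚ p ≤ fromℚ q
    fromℚ-mono {p} {q} p≤q = mk λ r◂p → fromℚ-intro q (ℚ.<-≤-trans (fromℚ-elim p r◂p) p≤q)

    fromℚ-+ : ∀ p q → fromℚ p + fromℚ q ≤ fromℚ (p ℚ.+ q)
    fromℚ-+ p q = mk λ t →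
      let (r , s , r◂p , s◂q , lt) = +-elim (fromℚ p) (fromℚ q) t
      in fromℚ-intro (p ℚ.+ q)
        (ℚ.<-trans lt (ℚ.+-mono-< (fromℚ-elim p r◂p) (fromℚ-elim q s◂q)))

    ≤-fromℚ : ∀ {q x} → q ◂ x → fromℚ q ≤ x
    ≤-fromℚ {q} q◂x = mk λ p → ◂-closed (fromℚ-elim q p) q◂x

    ≤-approx : ∀ {x y} → (∀ {ε} → 0ℚ ℚ.< ε → x ≤ y + fromℚ ε) → x ≤ y
    ≤-approx {x} {y} h = mk λ {q} q◂x →
      let (p , q<p , p◂x) = up q◂x
          ε = p ℚ.- q
          (r , s , r◂y , s◂ε , p<r+s) = +-elim y (fromℚ ε) (on (h (minus-pos q<p)) p◂x)
      in ◂-closed-≤ (ℚ.≮⇒≥ λ r<q → ℚ.<-irrefl refl (ℚ.<-trans p<r+s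
           (subst (r ℚ.+ s ℚ.<_) (+-minus q p) (ℚ.+-mono-< r<q (fromℚ-elim ε s◂ε))))) r◂y

    <-+ : ∀ x {ε} → 0ℚ ℚ.< ε → x < x + fromℚ ε
    <-+ x {ε} 0<ε x+ε≤x = ¬b◂x (◂-closed-≤ (subst (ℚ._≤ q ℚ.+ n · δ) (+-minus q b)
        (ℚ.+-monoʳ-≤ q (proj₂ (archimedean 0<δ (b ℚ.- q))))) (steps n))
      where
      δ = proj₁ (ℚ.<-dense 0<ε)
      0<δ : 0ℚ ℚ.< δ
      0<δ = proj₁ (proj₂ (ℚ.<-dense 0<ε))
      δ<ε : δ ℚ.< ε
      δ<ε = proj₂ (proj₂ (ℚ.<-dense 0<ε))
      q = proj₁ (∃-below x)
      b = proj₁ (∃-above x)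
      ¬b◂x = proj₂ (∃-above x)
      n = proj₁ (archimedean 0<δ (b ℚ.- q))
      step : ∀ {r} → r ◂ x → r ℚ.+ δ ◂ x
      step r◂x = let (r′ , r<r′ , r′◂x) = up r◂x in
        on x+ε≤x (+-intro x (fromℚ ε) (r′ , δ , r′◂x , fromℚ-intro ε δ<ε , ℚ.+-monoˡ-< δ r<r′))
      steps : ∀ n → q ℚ.+ n · δ ◂ x
      steps zero    = subst (_◂ x) (sym (ℚ.+-identityʳ q)) (proj₂ (∃-below x))
      steps (suc n) = subst (_◂ x)
        (trans (ℚ.+-assoc q (n · δ) δ) (cong (q ℚ.+_) (ℚ.+-comm (n · δ) δ))) (step (steps n))

    ∃-rational-below : ∀ {ε} → 0ᵣ < ε → ∃ λ q → 0ℚ ℚ.< q × fromℚ q ≤ ε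
    ∃-rational-below {ε} 0<ε = by-contradiction λ none → 0<ε (mk λ {q} q◂ε →
      fromℚ-intro 0ℚ (ℚ.≰⇒> λ 0≤q →
        let (p , q<p , p◂ε) = up q◂ε
        in none (p , ℚ.≤-<-trans 0≤q q<p , ≤-fromℚ p◂ε)))

    fromℚ-pos : ∀ {q} → 0ℚ ℚ.< q → 0ᵣ < fromℚ q
    fromℚ-pos {q} 0<q q≤0 =
      ℚ.<-irrefl refl (fromℚ-elim 0ℚ (on q≤0 (fromℚ-intro q 0<q)))

    ∃-half : ∀ {ε} → 0ᵣ < ε → ∃ λ q → 0ℚ ℚ.< q × fromℚ q + fromℚ q ≤ ε
    ∃-half {ε} 0<ε =
      let (p , 0<p , p≤ε) = ∃-rational-below 0<ε
          h = ½ ℚ.* p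
      in h , subst (ℚ._< h) (ℚ.*-zeroʳ ½) (ℚ.*-monoʳ-<-pos ½ 0<p)
       , ≤-trans (fromℚ-+ h h) (≤-trans
           (fromℚ-mono (ℚ.≤-reflexive (trans (sym (ℚ.*-distribʳ-+ p ½ ½)) (ℚ.*-identityˡ p)))) p≤ε)

    neg-adjoint : ∀ {x y} → - x ≤ y → - y ≤ x
    neg-adjoint {x} {y} h = mk λ {q} q◂-y →
      let (r , q<r , ¬-r◂y) = neg-elim y q◂-y
      in by-contradiction λ ¬q◂x → ¬-r◂y (on h (neg-intro x
           (ℚ.- q , ℚ.neg-antimono-< q<r , subst (λ p → ¬ p ◂ x) (sym (neg-neg q)) ¬q◂x)))

    ≤-neg-neg : ∀ x → x ≤ - - x
    ≤-neg-neg x = mk λ {q} q◂x →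
      let (p , q<p , p◂x) = up q◂x
      in neg-intro (- x) (p , q<p , λ -p◂-x →
           let (r , -p<r , ¬-r◂x) = neg-elim x -p◂-x
           in ¬-r◂x (◂-closed (subst (ℚ.- r ℚ.<_) (neg-neg p) (ℚ.neg-antimono-< -p<r)) p◂x))

    neg-antitone : ∀ {x y} → x ≤ y → - y ≤ - x
    neg-antitone x≤y = neg-adjoint (≤-trans (neg-adjoint ≤-refl) x≤y)

    neg-shift : ∀ {x y ε} → y ≤ x + fromℚ ε → - x ≤ - y + fromℚ ε
    neg-shift {x} {y} {ε} h = mk λ {q} q◂-x →
      let (r , q<r , ¬-r◂x) = neg-elim x q◂-x
          (t , q<t , t<r) = ℚ.<-dense q<r
          c = (q ℚ.- t) ℚ.+ ε
          c<ε = subst (c ℚ.<_) (trans (cong (ℚ._+ ε) (ℚ.+-inverseʳ t)) (ℚ.+-identityˡ ε))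
                  (ℚ.+-monoˡ-< ε (ℚ.+-monoˡ-< (ℚ.- t) q<t))
          (s , c<s , s<ε) = ℚ.<-dense c<ε
      in +-intro (- y) (fromℚ ε)
        ( t ℚ.- ε , s
        , neg-intro y
            ( r ℚ.- ε , ℚ.+-monoˡ-< (ℚ.- ε) t<r
            , λ ε-r◂y →
                let (a , b , a◂x , b◂ε , lt) = +-elim x (fromℚ ε) (on h ε-r◂y)
                in ¬-r◂x (◂-closed-≤ (ℚ.≮⇒≥ λ a<-r → ℚ.<-irrefl refl (ℚ.<-trans lt
                     (subst (a ℚ.+ b ℚ.<_) (solve₁ r ε)
                       (ℚ.+-mono-< a<-r (fromℚ-elim ε b◂ε))))) a◂x))
        , fromℚ-intro ε s<ε
        , subst (ℚ._< (t ℚ.- ε) ℚ.+ s) (solve₂ q t ε) (ℚ.+-monoʳ-< (t ℚ.- ε) c<s))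
      where
      open +-*-Solver
      solve₁ : ∀ r ε → (ℚ.- r) ℚ.+ ε ≡ ℚ.- (r ℚ.- ε)
      solve₁ = solve 2 (λ r ε → (:- r) :+ ε := :- (r :- ε)) refl
      solve₂ : ∀ q t ε → (t ℚ.- ε) ℚ.+ ((q ℚ.- t) ℚ.+ ε) ≡ q
      solve₂ = solve 3 (λ q t ε → (t :- ε) :+ ((q :- t) :+ ε) := q) refl

    max-≤ˡ : ∀ x y → x ≤ max x y
    max-≤ˡ x y = mk λ p → max-intro x y (inj₁ p)

    max-≤ʳ : ∀ x y → y ≤ max x y
    max-≤ʳ x y = mk λ p → max-intro x y (inj₂ p)

    max-lub : ∀ {x y z} → x ≤ z → y ≤ z → max x y ≤ z
    max-lub {x} {y} a b = mk λ p → cases (max-elim x y p)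
      where
      cases : ∀ {q} → q ◂ x ⊎ q ◂ y → q ◂ _
      cases (inj₁ p) = on a p
      cases (inj₂ p) = on b p

    min-≤ˡ : ∀ x y → min x y ≤ x
    min-≤ˡ x y = mk λ p → proj₁ (min-elim x y p)

    min-≤ʳ : ∀ x y → min x y ≤ y
    min-≤ʳ x y = mk λ p → proj₂ (min-elim x y p)

    min-glb : ∀ {x y z} → z ≤ x → z ≤ y → z ≤ min x y
    min-glb {x} {y} a b = mk λ p → min-intro x y (on a p , on b p)

    min-sel : ∀ x y → x ≤ min x y ⊎ y ≤ min x y
    min-sel x y with em {P = x ≤ y}
    ... | yes x≤y = inj₁ (min-glb ≤-refl x≤y)
    ... | no x≰y  = inj₂ (min-glb (≤-total x≰y) ≤-refl)

    module _ {I : Set ℓ} {f : I → ℝ} {b : ℝ} (b≤f : ∀ i → b ≤ f i) where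

      inf-≤ : ∀ i → inf f ≤ f i
      inf-≤ i = neg-adjoint (≤-sup (λ i → neg-antitone (b≤f i)) i)

      ≤-inf : I → ∀ {c} → (∀ i → c ≤ f i) → c ≤ inf f
      ≤-inf i₀ c≤f = ≤-trans (≤-neg-neg _)
        (neg-antitone (sup-≤ i₀ (λ i → neg-antitone (c≤f i))))

    0≤fromℚ : ∀ {q} → 0ℚ ℚ.< q → 0ᵣ ≤ fromℚ q
    0≤fromℚ 0<q = fromℚ-mono (ℚ.<⇒≤ 0<q)

    ≤-approx² : ∀ {x y z} → (∀ {ε} → 0ℚ ℚ.< ε → x ≤ (y + fromℚ ε) + (z + fromℚ ε)) → x ≤ y + z
    ≤-approx² h = ≤-approx λ 0<ε →
      let (δ , 0<δ , δδ≤ε) = ∃-half (fromℚ-pos 0<ε)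
      in ≤-trans (h 0<δ) (≤-trans (+-interchange _ _ _ _) (+-mono ≤-refl δδ≤ε))

  open ℝ-Lemmas

  -- |x - y| ≤ ε
  Within : ℝ → ℝ → ℝ → Set
  Within ε x y = x ≤ y + ε × y ≤ x + ε

  record Connective (n : ℕ) : Set where
    field
      apply      : Vector ℝ n → ℝ
      continuous : ∀ v ε → 0ᵣ < ε → ∃ λ δ → 0ᵣ < δ ×
                   (∀ w → (∀ i → Within δ (v i) (w i)) → Within ε (apply v) (apply w))

  open Connective public using (apply)

  Nondecreasing : Connective 1 → Set
  Nondecreasing C = ∀ x y → x ≤ y → apply C (x ∷ []) ≤ apply C (y ∷ [])

  Nonincreasing : Connective 1 → Set
  Nonincreasing C = ∀ x y → x ≤ y → apply C (y ∷ []) ≤ apply C (x ∷ [])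

  maximum minimum : ∀ {n} → Vector ℝ (suc n) → ℝ
  maximum {zero}  v = head v
  maximum {suc n} v = max (head v) (maximum (tail v))
  minimum {zero}  v = head v
  minimum {suc n} v = min (head v) (minimum (tail v))

  module Connective-Lemmas where

    max-shift : ∀ {x y x′ y′ ε} → x ≤ x′ + ε → y ≤ y′ + ε → max x y ≤ max x′ y′ + ε
    max-shift a b = max-lub (≤-trans a (+-mono (max-≤ˡ _ _) ≤-refl))
                            (≤-trans b (+-mono (max-≤ʳ _ _) ≤-refl))

    min-shift : ∀ {x y x′ y′ ε} → x ≤ x′ + ε → y ≤ y′ + ε → min x y ≤ min x′ y′ + ε
    min-shift {x} {y} {x′} {y′} a b with min-sel x′ y′
    ... | inj₁ p = ≤-trans (min-≤ˡ x y) (≤-trans a (+-mono p ≤-refl))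
    ... | inj₂ p = ≤-trans (min-≤ʳ x y) (≤-trans b (+-mono p ≤-refl))

    maximum-shift : ∀ {n ε} {v w : Vector ℝ (suc n)} →
                    (∀ i → v i ≤ w i + ε) → maximum v ≤ maximum w + ε
    maximum-shift {zero}  h = h zero
    maximum-shift {suc n} h = max-shift (h zero) (maximum-shift (h ∘ suc))

    minimum-shift : ∀ {n ε} {v w : Vector ℝ (suc n)} →
                    (∀ i → v i ≤ w i + ε) → minimum v ≤ minimum w + ε
    minimum-shift {zero}  h = h zero
    minimum-shift {suc n} h = min-shift (h zero) (minimum-shift (h ∘ suc))

    difference-shift : ∀ {x y x′ y′ ε δ} → fromℚ δ + fromℚ δ ≤ ε →
                       x ≤ x′ + fromℚ δ → y′ ≤ y + fromℚ δ → x + (- y) ≤ (x′ + (- y′)) + ε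
    difference-shift 2δ≤ε a b = ≤-trans (+-mono a (neg-shift b))
      (≤-trans (+-interchange _ _ _ _) (+-mono ≤-refl 2δ≤ε))

  open Connective-Lemmas

  constᶜ : ℝ → Connective 0
  constᶜ r = record
    { apply      = λ _ → r
    ; continuous = λ _ ε 0<ε → ε , 0<ε , λ _ _ → ≤+ r (<⇒≤ 0<ε) , ≤+ r (<⇒≤ 0<ε)
    }

  maxᶜ minᶜ : ∀ {n} → Connective (suc n)
  maxᶜ = record
    { apply      = maximum
    ; continuous = λ _ ε 0<ε → ε , 0<ε , λ _ h →
        maximum-shift (proj₁ ∘ h) , maximum-shift (proj₂ ∘ h)
    }
  minᶜ = record
    { apply      = minimum
    ; continuous = λ _ ε 0<ε → ε , 0<ε , λ _ h →
        minimum-shift (proj₁ ∘ h) , minimum-shift (proj₂ ∘ h)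
    }

  differenceᶜ : Connective 2
  differenceᶜ = record
    { apply      = λ v → v zero + (- v (suc zero))
    ; continuous = λ _ ε 0<ε →
        let (δ , 0<δ , 2δ≤ε) = ∃-half 0<ε
        in fromℚ δ , fromℚ-pos 0<δ , λ _ h →
          difference-shift 2δ≤ε (proj₁ (h zero)) (proj₂ (h (suc zero))) ,
          difference-shift 2δ≤ε (proj₂ (h zero)) (proj₁ (h (suc zero)))
    }

  record Filter (I : Set ℓ) : Set (lsuc ℓ) where
    field
      sets   : Pred (Pred I ℓ) ℓ
      whole  : (λ _ → ⊤) ∈ sets
      upward : ∀ {J K} → J ⊆ K → J ∈ sets → K ∈ sets
      meet   : ∀ {J K} → J ∈ sets → K ∈ sets → J ∩ K ∈ sets
      proper : ∀ {J} → J ∈ sets → Satisfiable J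

  open Filter public using (sets)

  Fréchet : ∀ ℓ → Filter (Lift ℓ ℕ)
  Fréchet ℓ = record
    { sets   = λ J → ∃ λ n → ∀ m → n ℕ.≤ m → J (lift m)
    ; whole  = 0 , λ _ _ → tt
    ; upward = λ J⊆K (n , h) → n , λ m n≤m → J⊆K (h m n≤m)
    ; meet   = λ (n , h) (k , g) → n ℕ.⊔ k , λ m le →
                 h m (ℕ.≤-trans (ℕ.m≤m⊔n n k) le) , g m (ℕ.≤-trans (ℕ.m≤n⊔m n k) le)
    ; proper = λ (n , h) → lift n , h n ℕ.≤-refl
    }

  limsup : {I : Set ℓ} → Filter I → (I → ℝ) → ℝ
  limsup {I = I} F u =
    inf {I = Σ (Pred I _) (_∈ sets F)} (λ (J , _) → sup {I = Σ I J} (λ (i , _) → u i))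

  module Limsup-Lemmas {I : Set ℓ} (F : Filter I) where

    open Filter F using (whole; upward; meet; proper)

    module _ {u : I → ℝ} {lo hi : ℝ} (lo≤u : ∀ i → lo ≤ u i) (u≤hi : ∀ i → u i ≤ hi) where

      private
        sup-on : Σ (Pred I ℓ) (_∈ sets F) → ℝ
        sup-on (J , _) = sup {I = Σ I J} (λ (i , _) → u i)

        lo≤sup : ∀ s → lo ≤ sup-on s
        lo≤sup (J , J∈F) = let (i , i∈J) = proper J∈F in
          ≤-trans (lo≤u i) (≤-sup (λ (i , _) → u≤hi i) (i , i∈J))

      limsup-≤ : ∀ {J c} → J ∈ sets F → (∀ i → i ∈ J → u i ≤ c) → limsup F u ≤ c
      limsup-≤ J∈F h = ≤-trans (inf-≤ lo≤sup (_ , J∈F))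
        (sup-≤ (proper J∈F) (λ (i , i∈J) → h i i∈J))

      limsup-≥ : lo ≤ limsup F u
      limsup-≥ = ≤-inf lo≤sup (_ , whole) lo≤sup

      limsup-< : ∀ {c} → limsup F u < c → ∃ λ J → J ∈ sets F × (∀ i → i ∈ J → u i < c)
      limsup-< {c} l<c = by-contradiction λ none → l<c (≤-inf lo≤sup (_ , whole)
        λ (J , J∈F) → by-contradiction λ c≰sup → none (J , J∈F , λ i i∈J c≤ui →
          c≰sup (≤-trans c≤ui (≤-sup (λ (i , _) → u≤hi i) (i , i∈J)))))

      limsup-≤⁻ : ∀ {c ε} → limsup F u ≤ c → 0ℚ ℚ.< ε →
                  ∃ λ J → J ∈ sets F × (∀ i → i ∈ J → u i ≤ c + fromℚ ε)
      limsup-≤⁻ l≤c 0<ε =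
        let (J , J∈F , h) = limsup-< (≤-<-trans l≤c (<-+ _ 0<ε))
        in J , J∈F , λ i i∈J → <⇒≤ (h i i∈J)

    meets : ∀ {n} (J : Vector (Pred I ℓ) n) → (∀ k → J k ∈ sets F) →
            ∃ λ K → K ∈ sets F × (∀ k → K ⊆ J k)
    meets {zero}  J h = (λ _ → ⊤) , whole , λ ()
    meets {suc n} J h =
      let (K , K∈F , K⊆) = meets (tail J) (h ∘ suc)
      in head J ∩ K , meet (h zero) K∈F , λ { zero (p , _) → p ; (suc k) (_ , q) → K⊆ k q }

  record Modulus : Set where
    field
      δ      : ℝ → ℝ
      δ-cong : ∀ {x y} → x ≈ y → δ x ≈ δ y
      δ-pos  : ∀ {ε} → 0ᵣ < ε → 0ᵣ < δ ε

  open Modulus public using (δ)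

  record Signature ℓ : Set (lsuc ℓ) where
    field
      FunctionSymbol  : Set ℓ
      funArity        : FunctionSymbol → ℕ
      funModulus      : FunctionSymbol → Modulus
      PredicateSymbol : Set ℓ
      predArity       : PredicateSymbol → ℕ
      predModulus     : PredicateSymbol → Modulus
      predLower       : PredicateSymbol → ℝ
      predUpper       : PredicateSymbol → ℝ
      diameter        : ℝ

  Cauchy : {A : Set ℓ} → (A → A → ℝ) → (ℕ → A) → Set
  Cauchy d s = ∀ ε → 0ᵣ < ε → ∃ λ N → ∀ m n → N ℕ.≤ m → N ℕ.≤ n → d (s m) (s n) ≤ ε

  Converges : {A : Set ℓ} → (A → A → ℝ) → (ℕ → A) → A → Set
  Converges d s l = ∀ ε → 0ᵣ < ε → ∃ λ N → ∀ n → N ℕ.≤ n → d (s n) l ≤ ε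

  -- The domain is a setoid, whose equality is that of the metric space; it plays
  -- the role of a quotient in reduced products.  Uniform continuity is for the
  -- maximum metric on tuples.
  record Structure (L : Signature ℓ) : Set (lsuc ℓ) where
    open Signature L
    infix 4 _≈ᴹ_
    field
      Carrier  : Set ℓ
      _≈ᴹ_     : Rel Carrier 0ℓ
      d        : Carrier → Carrier → ℝ
      isMetric : IsGeneralMetric _≈ᴹ_ _≈_ _≤_ 0ᵣ _+_ d
      nonempty : Carrier
      complete : ∀ s → Cauchy d s → ∃ (Converges d s)
      bounded  : ∀ a b → d a b ≤ diameter

      fun          : ∀ f → Vector Carrier (funArity f) → Carrier
      fun-uniform  : ∀ f ε → 0ᵣ < ε → ∀ a b →
                     (∀ k → d (a k) (b k) < δ (funModulus f) ε) → d (fun f a) (fun f b) ≤ ε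

      pred         : ∀ p → Vector Carrier (predArity p) → ℝ
      pred-uniform : ∀ p ε → 0ᵣ < ε → ∀ a b →
                     (∀ k → d (a k) (b k) < δ (predModulus p) ε) → Within ε (pred p a) (pred p b)
      pred-lower   : ∀ p a → predLower p ≤ pred p a
      pred-upper   : ∀ p a → pred p a ≤ predUpper p

  module Metric-Lemmas where

    -- A pseudometric is a metric on the setoid whose equality is d a b = 0.
    pseudometric : {A : Set ℓ} {d : A → A → ℝ} →
                   (∀ a b → 0ᵣ ≤ d a b) → (∀ a → d a a ≤ 0ᵣ) → (∀ a b → d a b ≤ d b a) →
                   (∀ a b c → d a c ≤ d a b + d b c) →
                   IsGeneralMetric (λ a b → d a b ≈ 0ᵣ) _≈_ _≤_ 0ᵣ _+_ d
    pseudometric {d = d} d-nonneg d-refl d-sym d-tri = record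
      { isSemiMetric = record
        { isQuasiSemiMetric = record
          { isPreMetric = record
            { isProtoMetric = record
              { isPartialOrder  = ≤-isPartialOrder
              ; ≈-isEquivalence = record
                { refl  = zero-if (d-refl _)
                ; sym   = λ (p , _) → zero-if (≤-trans (d-sym _ _) p)
                ; trans = λ (p , _) (q , _) →
                    zero-if (≤-trans (d-tri _ _ _) (≤-trans (+-mono p q) 0+0≤0))
                }
              ; cong = λ (p , _) (q , _) →
                  shift p q , shift (≤-trans (d-sym _ _) p) (≤-trans (d-sym _ _) q)
              ; nonNegative = d-nonneg _ _
              }
            ; ≈⇒0 = λ e → e
            }
          ; 0⇒≈ = λ e → e
          }
        ; sym = λ _ _ → d-sym _ _ , d-sym _ _
        }
      ; triangle = λ _ _ _ → d-tri _ _ _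
      }
      where
      zero-if : ∀ {a b} → d a b ≤ 0ᵣ → d a b ≈ 0ᵣ
      zero-if p = p , d-nonneg _ _
      0+0≤0 : 0ᵣ + 0ᵣ ≤ 0ᵣ
      0+0≤0 = fromℚ-+ 0ℚ 0ℚ
      x+0≤x : ∀ x → x + 0ᵣ ≤ x
      x+0≤x x = ≤-approx λ 0<ε → +-mono ≤-refl (0≤fromℚ 0<ε)
      shift : ∀ {a b a′ b′} → d a a′ ≤ 0ᵣ → d b b′ ≤ 0ᵣ → d a b ≤ d a′ b′
      shift {a} {b} {a′} {b′} p q =
        ≤-trans (d-tri a a′ b) (≤-trans (+-mono p (d-tri a′ b′ b)) (≤-trans (+-comm _ _)
          (≤-trans (x+0≤x _) (≤-trans (+-mono ≤-refl (≤-trans (d-sym _ _) q)) (x+0≤x _)))))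

    ½ʳ : ℕ → ℝ
    ½ʳ k = fromℚ (½^ k)

    ½ʳ-pos : ∀ k → 0ᵣ < ½ʳ k
    ½ʳ-pos k = fromℚ-pos (½^-pos k)

    ½ʳ-double : ∀ k → ½ʳ (suc k) + ½ʳ (suc k) ≤ ½ʳ k
    ½ʳ-double k = ≤-trans (fromℚ-+ _ _) (fromℚ-mono (ℚ.≤-reflexive (½^-double k)))

    ½ʳ-small : ∀ {ε} → 0ᵣ < ε → ∃ λ k → ½ʳ k ≤ ε
    ½ʳ-small 0<ε =
      let (q , 0<q , q≤ε) = ∃-rational-below 0<ε
          (k , ½^k≤q) = ½^-small 0<q
      in k , ≤-trans (fromℚ-mono ½^k≤q) q≤ε

  open Metric-Lemmas

  module ReducedProduct {L : Signature ℓ} {I : Set ℓ} (M : I → Structure L) (F : Filter I) where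

    open Signature L
    open Structure using (Carrier; d; isMetric; nonempty; complete; bounded; fun; pred)
    open Limsup-Lemmas F

    private
      module Mᵢ (i : I) = IsGeneralMetric (isMetric (M i))

    Product : Set ℓ
    Product = ∀ i → Carrier (M i)

    d-F : Product → Product → ℝ
    d-F a b = limsup F (λ i → d (M i) (a i) (b i))

    fun-F : ∀ f → Vector Product (funArity f) → Product
    fun-F f a i = fun (M i) f (λ k → a k i)

    pred-F : ∀ p → Vector Product (predArity p) → ℝ
    pred-F p a = limsup F (λ i → pred (M i) p (λ k → a k i))

    module Construction where
      dᵢ : ∀ (a b : Product) i → ℝ
      dᵢ a b i = d (M i) (a i) (b i)

      0≤dᵢ : ∀ a b i → 0ᵣ ≤ dᵢ a b i
      0≤dᵢ a b i = Mᵢ.nonNegative i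

      dᵢ≤ : ∀ a b i → dᵢ a b i ≤ diameter
      dᵢ≤ a b i = bounded (M i) (a i) (b i)

      d-≤ : ∀ {a b J c} → J ∈ sets F → (∀ i → i ∈ J → dᵢ a b i ≤ c) → d-F a b ≤ c
      d-≤ {a} {b} = limsup-≤ (0≤dᵢ a b) (dᵢ≤ a b)

      d-≤⁻ : ∀ {a b c ε} → d-F a b ≤ c → 0ℚ ℚ.< ε →
             ∃ λ J → J ∈ sets F × (∀ i → i ∈ J → dᵢ a b i ≤ c + fromℚ ε)
      d-≤⁻ {a} {b} = limsup-≤⁻ (0≤dᵢ a b) (dᵢ≤ a b)

      d-<⁻ : ∀ {n c} {a b : Vector Product n} → (∀ k → d-F (a k) (b k) < c) →
             ∃ λ J → J ∈ sets F × (∀ i → i ∈ J → ∀ k → dᵢ (a k) (b k) i < c)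
      d-<⁻ {c = c} {a} {b} h =
        let (K , K∈F , K⊆) = meets (λ k → proj₁ (near k)) (λ k → proj₁ (proj₂ (near k)))
        in K , K∈F , λ i i∈K k → proj₂ (proj₂ (near k)) i (K⊆ k i∈K)
        where
        near : ∀ k → ∃ λ J → J ∈ sets F × (∀ i → i ∈ J → dᵢ (a k) (b k) i < c)
        near k = limsup-< (0≤dᵢ (a k) (b k)) (dᵢ≤ (a k) (b k)) (h k)

      d-tri : ∀ a b c → d-F a c ≤ d-F a b + d-F b c
      d-tri a b c = ≤-approx² λ 0<ε →
        let (J , J∈F , h) = d-≤⁻ {a} {b} ≤-refl 0<ε
            (K , K∈F , g) = d-≤⁻ {b} {c} ≤-refl 0<ε
        in d-≤ {a} {c} (Filter.meet F J∈F K∈F) λ i (i∈J , i∈K) →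
             ≤-trans (Mᵢ.triangle i (a i) (b i) (c i)) (+-mono (h i i∈J) (g i i∈K))

      d-sym : ∀ a b → d-F a b ≤ d-F b a
      d-sym a b = ≤-approx λ 0<ε →
        let (J , J∈F , h) = d-≤⁻ {b} {a} ≤-refl 0<ε
        in d-≤ {a} {b} J∈F λ i i∈J → ≤-trans (proj₁ (Mᵢ.sym i (a i) (b i))) (h i i∈J)

      d-refl : ∀ a → d-F a a ≤ 0ᵣ
      d-refl a = d-≤ {a} {a} (Filter.whole F) λ i _ → proj₁ (Mᵢ.≈⇒0 i (Mᵢ.EqC.refl i))

      d-F-isMetric : IsGeneralMetric (λ a b → d-F a b ≈ 0ᵣ) _≈_ _≤_ 0ᵣ _+_ d-F
      d-F-isMetric = pseudometric
        (λ a b → limsup-≥ (0≤dᵢ a b) (dᵢ≤ a b)) d-refl d-sym d-tri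

      pred-≤ : ∀ p {a b ε} → (∃ λ J → J ∈ sets F × (∀ i → i ∈ J →
                 pred (M i) p (λ k → a k i) ≤ pred (M i) p (λ k → b k i) + ε)) →
               pred-F p a ≤ pred-F p b + ε
      pred-≤ p {a} {b} {ε} (J , J∈F , h) = ≤-approx λ {η} 0<η →
        let (K , K∈F , g) = limsup-≤⁻ (lo b) (hi b) ≤-refl 0<η
        in limsup-≤ (lo a) (hi a) (Filter.meet F J∈F K∈F) λ i (i∈J , i∈K) →
             ≤-trans (h i i∈J) (≤-trans (+-mono (g i i∈K) ≤-refl)
               (≤-trans (+-assoc _ _ _) (≤-trans (+-mono ≤-refl (+-comm _ _)) (+-assoc⁻ _ _ _))))
        where
        lo : ∀ c i → predLower p ≤ pred (M i) p (λ k → c k i)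
        lo c i = Structure.pred-lower (M i) p _
        hi : ∀ c i → pred (M i) p (λ k → c k i) ≤ predUpper p
        hi c i = Structure.pred-upper (M i) p _

      -- Thin the sequence s to t with d-F (t k) (t (suc k)) ≤ ½ʳ (suc k).  In the
      -- coordinate i, follow t for as long as it stays ½ʳ k close to its successor,
      -- and be constant afterwards: the resulting sequence u is Cauchy in M i.
      module Completeness (s : ℕ → Product) (s-cauchy : Cauchy d-F s) where

        stage : ∀ k → ∃ λ N → ∀ m n → N ℕ.≤ m → N ℕ.≤ n → d-F (s m) (s n) ≤ ½ʳ (suc k)
        stage k = s-cauchy (½ʳ (suc k)) (½ʳ-pos (suc k))

        idx : ℕ → ℕ
        idx zero    = proj₁ (stage 0)
        idx (suc k) = idx k ℕ.⊔ proj₁ (stage (suc k))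

        stage≤idx : ∀ k → proj₁ (stage k) ℕ.≤ idx k
        stage≤idx zero    = ℕ.≤-refl
        stage≤idx (suc k) = ℕ.m≤n⊔m (idx k) _

        t : ℕ → Product
        t k = s (idx k)

        opaque
          close : ∀ k → ∃ λ J → J ∈ sets F × (∀ i → i ∈ J → dᵢ (t k) (t (suc k)) i ≤ ½ʳ k)
          close k =
            let (J , J∈F , h) = d-≤⁻ {t k} {t (suc k)} (proj₂ (stage k) (idx k) (idx (suc k)) (stage≤idx k)
                                       (ℕ.≤-trans (stage≤idx k) (ℕ.m≤m⊔n (idx k) _))) (½^-pos (suc k))
            in J , J∈F , λ i i∈J → ≤-trans (h i i∈J) (½ʳ-double k)

        K : ℕ → Pred I ℓ
        K zero    = λ _ → ⊤
        K (suc k) = K k ∩ proj₁ (close k)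

        K∈F : ∀ k → K k ∈ sets F
        K∈F zero    = Filter.whole F
        K∈F (suc k) = Filter.meet F (K∈F k) (proj₁ (proj₂ (close k)))

        module _ (i : I) where

          u : ℕ → Carrier (M i)
          u zero    = t 0 i
          u (suc k) with em {P = i ∈ K (suc k)}
          ... | yes _ = t (suc k) i
          ... | no _  = u k

          u≡t : ∀ k → i ∈ K k → u k ≡ t k i
          u≡t zero    _ = refl
          u≡t (suc k) i∈K with em {P = i ∈ K (suc k)}
          ... | yes _  = refl
          ... | no i∉K = ⊥-elim (i∉K i∈K)

          d-refl-≤ : ∀ {a c} → 0ᵣ ≤ c → d (M i) a a ≤ c
          d-refl-≤ 0≤c = ≤-trans (proj₁ (Mᵢ.≈⇒0 i (Mᵢ.EqC.refl i))) 0≤c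

          u-step : ∀ k → d (M i) (u k) (u (suc k)) ≤ ½ʳ k
          u-step k with em {P = i ∈ K (suc k)}
          ... | no _              = d-refl-≤ (<⇒≤ (½ʳ-pos k))
          ... | yes (i∈K , i∈J) rewrite u≡t k i∈K = proj₂ (proj₂ (close k)) i i∈J

          u-dist : ∀ j k → d (M i) (u k) (u (j ℕ.+ k)) ≤ ½ʳ k + ½ʳ k
          u-dist zero    k = d-refl-≤ (≤-trans (<⇒≤ (½ʳ-pos k)) (≤+ _ (<⇒≤ (½ʳ-pos k))))
          u-dist (suc j) k = ≤-trans (Mᵢ.triangle i (u k) (u (suc k)) (u (suc j ℕ.+ k)))
            (+-mono (u-step k) (≤-trans (subst
              (λ n → d (M i) (u (suc k)) (u n) ≤ ½ʳ (suc k) + ½ʳ (suc k))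
              (ℕ.+-suc j k) (u-dist j (suc k))) (½ʳ-double k)))

          u-dist-≤ : ∀ {k m} → k ℕ.≤ m → d (M i) (u k) (u m) ≤ ½ʳ k + ½ʳ k
          u-dist-≤ {k} {m} k≤m = subst (λ n → d (M i) (u k) (u n) ≤ ½ʳ k + ½ʳ k)
            (ℕ.m∸n+n≡m k≤m) (u-dist (m ℕ.∸ k) k)

          u-cauchy : Cauchy (d (M i)) u
          u-cauchy ε 0<ε =
            let (k , ½k≤ε) = ½ʳ-small 0<ε
                N = suc (suc k)
                half : ½ʳ N + ½ʳ N ≤ ½ʳ (suc k)
                half = ½ʳ-double (suc k)
            in N , λ m n N≤m N≤n → ≤-trans (Mᵢ.triangle i (u m) (u N) (u n))
                 (≤-trans (+-mono
                   (≤-trans (proj₁ (Mᵢ.sym i (u m) (u N))) (≤-trans (u-dist-≤ N≤m) half))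
                   (≤-trans (u-dist-≤ N≤n) half))
                   (≤-trans (½ʳ-double k) ½k≤ε))

          limit : Carrier (M i)
          limit = proj₁ (complete (M i) u u-cauchy)

          u-limit : ∀ k → d (M i) (u k) limit ≤ (½ʳ k + ½ʳ k) + ½ʳ k
          u-limit k =
            let (N , h) = proj₂ (complete (M i) u u-cauchy) (½ʳ k) (½ʳ-pos k)
            in ≤-trans (Mᵢ.triangle i (u k) (u (k ℕ.⊔ N)) limit)
                 (+-mono (u-dist-≤ (ℕ.m≤m⊔n k N)) (h (k ℕ.⊔ N) (ℕ.m≤n⊔m k N)))

        t-limit : ∀ k → d-F (t k) limit ≤ (½ʳ k + ½ʳ k) + ½ʳ k
        t-limit k = d-≤ {t k} {limit} (K∈F k) λ i i∈K →
          subst (λ a → d (M i) a (limit i) ≤ (½ʳ k + ½ʳ k) + ½ʳ k) (u≡t i k i∈K) (u-limit i k)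

        converges : Converges d-F s limit
        converges ε 0<ε =
          let (k₀ , ½≤ε) = ½ʳ-small 0<ε
              k = suc (suc k₀)
              e = ½ʳ k
          in idx k , λ n idx≤n →
            ≤-trans (d-tri (s n) (t k) limit)
              (≤-trans (+-mono (≤-trans (proj₂ (stage k) n (idx k)
                                          (ℕ.≤-trans (stage≤idx k) idx≤n) (stage≤idx k))
                                        (≤-trans (≤+ _ (<⇒≤ (½ʳ-pos (suc k)))) (½ʳ-double k)))
                               (t-limit k))
              (≤-trans (+-comm e ((e + e) + e))
              (≤-trans (+-assoc (e + e) e e)
              (≤-trans (+-mono (½ʳ-double (suc k₀)) (½ʳ-double (suc k₀)))
              (≤-trans (½ʳ-double k₀) ½≤ε)))))

    open Construction

    structure : Structure L
    structure = record
      { Carrier      = Product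
      ; _≈ᴹ_         = λ a b → d-F a b ≈ 0ᵣ
      ; d            = d-F
      ; isMetric     = d-F-isMetric
      ; nonempty     = λ i → nonempty (M i)
      ; complete     = λ s s-cauchy →
          Completeness.limit s s-cauchy , Completeness.converges s s-cauchy
      ; bounded      = λ a b → d-≤ {a} {b} (Filter.whole F) λ i _ → dᵢ≤ a b i
      ; fun          = fun-F
      ; fun-uniform  = λ f ε 0<ε a b h →
          let (J , J∈F , g) = d-<⁻ {a = a} {b} h
          in d-≤ {fun-F f a} {fun-F f b} J∈F λ i i∈J →
               Structure.fun-uniform (M i) f ε 0<ε _ _ (g i i∈J)
      ; pred         = pred-F
      ; pred-uniform = λ p ε 0<ε a b h →
          let (J , J∈F , g) = d-<⁻ {a = a} {b} h
              near = λ i i∈J → Structure.pred-uniform (M i) p ε 0<ε _ _ (g i i∈J)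
          in pred-≤ p {a} {b} (J , J∈F , λ i i∈J → proj₁ (near i i∈J))
           , pred-≤ p {b} {a} (J , J∈F , λ i i∈J → proj₂ (near i i∈J))
      ; pred-lower   = λ p a → limsup-≥ (λ i → Structure.pred-lower (M i) p _)
                                        (λ i → Structure.pred-upper (M i) p _)
      ; pred-upper   = λ p a → limsup-≤ (λ i → Structure.pred-lower (M i) p _)
                                        (λ i → Structure.pred-upper (M i) p _)
                                        (Filter.whole F) (λ i _ → Structure.pred-upper (M i) p _)
      }

  open ReducedProduct public using () renaming (structure to reducedProduct)

  -- Variables are de Bruijn indices: the free variables of φ : Formula L n are
  -- indexed by Fin n, and Inf and Sup bind index zero.
  data Term (L : Signature ℓ) (n : ℕ) : Set ℓ where
    var : Fin n → Term L n
    app : ∀ f → Vector (Term L n) (Signature.funArity L f) → Term L n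

  data Formula (L : Signature ℓ) : ℕ → Set ℓ where
    dist    : ∀ {n} → Term L n → Term L n → Formula L n
    atom    : ∀ {n} p → Vector (Term L n) (Signature.predArity L p) → Formula L n
    conn    : ∀ {n m} → Connective m → Vector (Formula L n) m → Formula L n
    Inf Sup : ∀ {n} → Formula L (suc n) → Formula L n

  Sentence : Signature ℓ → Set ℓ
  Sentence L = Formula L 0

  module _ {L : Signature ℓ} (M : Structure L) where

    open Structure M

    ⟦_⟧ᵗ : ∀ {n} → Term L n → Vector Carrier n → Carrier
    ⟦ var x ⟧ᵗ   ρ = ρ x
    ⟦ app f ts ⟧ᵗ ρ = fun f (λ k → ⟦ ts k ⟧ᵗ ρ)

    ⟦_⟧ : ∀ {n} → Formula L n → Vector Carrier n → ℝ
    ⟦ dist s t ⟧  ρ = d (⟦ s ⟧ᵗ ρ) (⟦ t ⟧ᵗ ρ)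
    ⟦ atom p ts ⟧ ρ = pred p (λ k → ⟦ ts k ⟧ᵗ ρ)
    ⟦ conn C φs ⟧ ρ = apply C (λ k → ⟦ φs k ⟧ ρ)
    ⟦ Inf φ ⟧     ρ = inf (λ a → ⟦ φ ⟧ (a ∷ ρ))
    ⟦ Sup φ ⟧     ρ = sup (λ a → ⟦ φ ⟧ (a ∷ ρ))

  -- The pair (φ , r) is the condition φ ≤ r.
  Theory : Signature ℓ → Set (lsuc ℓ)
  Theory {ℓ} L = Pred (Sentence L × ℝ) ℓ

  module _ {L : Signature ℓ} where

    _⊨_ : Structure L → Theory L → Set ℓ
    M ⊨ T = ∀ {φ r} → (φ , r) ∈ T → ⟦ M ⟧ φ [] ≤ r

    _⊨ᵀ_ : Theory L → Theory L → Set (lsuc ℓ)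
    T ⊨ᵀ S = ∀ M → M ⊨ T → M ⊨ S

    Complete : Theory L → Set (lsuc ℓ)
    Complete T = ∃ (_⊨ T) ×
      (∀ M N → M ⊨ T → N ⊨ T → ∀ (φ : Sentence L) → ⟦ M ⟧ φ [] ≈ ⟦ N ⟧ φ [])

    PreservedUnderReducedProducts : Theory L → Set (lsuc ℓ)
    PreservedUnderReducedProducts T =
      ∀ {I : Set ℓ} (M : I → Structure L) (F : Filter I) →
      (λ i → M i ⊨ T) ∈ sets F → reducedProduct M F ⊨ T

    PreservedUnderFréchetProducts : Theory L → Set (lsuc ℓ)
    PreservedUnderFréchetProducts T =
      ∀ (M : Lift ℓ ℕ → Structure L) → (∀ i → M i ⊨ T) → reducedProduct M (Fréchet ℓ) ⊨ T

    infixr 9 _$_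

    max₂ : ∀ {n} → Formula L n → Formula L n → Formula L n
    max₂ φ ψ = conn maxᶜ (φ ∷ ψ ∷ [])

    _$_ : ∀ {n} → Connective 1 → Formula L n → Formula L n
    C $ φ = conn C (φ ∷ [])

    infs : ∀ k {m} → Formula L (k ℕ.+ m) → Formula L m
    infs zero    φ = φ
    infs (suc k) φ = infs k (Inf φ)

    sups : ∀ m → Formula L m → Sentence L
    sups zero    φ = φ
    sups (suc m) φ = sups m (Sup φ)

    data Palyutin : ∀ {n} → Formula L n → Set ℓ where
      dist : ∀ {n} (s t : Term L n) → Palyutin (dist s t)
      atom : ∀ {n} p (ts : Vector (Term L n) _) → Palyutin (atom p ts)
      mono : ∀ {n} {φ : Formula L n} (C : Connective 1) → Nondecreasing C →
             Palyutin φ → Palyutin (C $ φ)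
      maxP : ∀ {n} {φ ψ : Formula L n} → Palyutin φ → Palyutin ψ → Palyutin (max₂ φ ψ)
      Inf  : ∀ {n} {φ : Formula L (suc n)} → Palyutin φ → Palyutin (Inf φ)
      Sup  : ∀ {n} {φ : Formula L (suc n)} → Palyutin φ → Palyutin (Sup φ)
      max-inf-sup : ∀ {n} {φ ψ : Formula L (suc n)} (D : Connective 1) (Δ : ℝ) →
             Nonincreasing D → apply D (Δ ∷ []) ≈ Δ → Palyutin φ → Palyutin ψ →
             Palyutin (max₂ (Inf φ)
                            (Sup (conn minᶜ ((D $ φ) ∷ conn (constᶜ Δ) [] ∷ ψ ∷ []))))

  -- In Formula L (k + m) the tuple x is the first k variables and y the last m,
  -- and there are suc (suc n) formulas ψ.
  data SCP (L : Signature ℓ) : Theory L where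
    scp : ∀ {n k m} {φ : Formula L (k ℕ.+ m)} {ψ : Vector (Formula L (k ℕ.+ m)) (suc (suc n))}
          (D : Vector (Connective 1) (suc (suc n))) →
          Palyutin φ → (∀ j → Palyutin (ψ j)) → (∀ j → Nonincreasing (D j)) →
          SCP L ( sups m (conn differenceᶜ
                    ( infs k (conn maxᶜ (φ ∷ λ j → D j $ ψ j))
                    ∷ conn maxᶜ (λ j → infs k (max₂ φ (D j $ ψ j)))
                    ∷ []))
                , 0ᵣ)

{-# OPTIONS --safe #-}
-- A Palyutin formula is evaluated in a reduced product as the limit superior of its
-- values in the factors (palyutin-continuous).  Consequently points of a reduced
-- product can be glued from points of the factors: along disjoint infinite subsets of
-- ω this makes every Fin*-product a model of SCP, and along the set of indices j whose
-- D j ψ j is small in a given factor it shows that reduced products preserve SCP.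
--
-- Modulo SCP, a formula is controlled by finitely many Palyutin formulas in the same
-- variables (determined).  Under a quantifier, the values of finitely many Palyutin
-- formulas at a point are recorded up to a grid by conditions φ ≤ 0 and ψ j ≥ 0; SCP
-- reduces their joint solvability to that of φ ≤ 0, ψ j ≥ 0 for single j, which the
-- Palyutin formulas inf φ and max (inf φ) (sup (min (- φ) 0 (ψ j))) express.
-- So models of SCP with the same values of Palyutin sentences are elementarily
-- equivalent, and a reduced product of models of T satisfies this with any model of T.
module Submission where

open import Axiom.ExcludedMiddle using (ExcludedMiddle)
open import Axiom.Extensionality.Propositional using (Extensionality)
open import Data.Empty using (⊥-elim)
open import Data.Fin.Base using (Fin; zero; suc; toℕ)
open import Data.Fin.Properties using (toℕ-fromℕ<; toℕ-injective; toℕ<n)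
open import Agda.Builtin.List using (List) renaming ([] to []ˡ; _∷_ to _∷ˡ_)
import Data.List.Base as List
open import Data.List.Membership.Propositional using () renaming (_∈_ to _∈ˡ_)
open import Data.List.Membership.Propositional.Properties
  using (∈-map⁺; ∈-++⁺ˡ; ∈-++⁺ʳ; ∈-concat⁺′; ∈-tabulate⁺)
open import Data.List.Relation.Unary.Any as Any using (here; there)
open import Data.List.Relation.Unary.Any.Properties using (lookup-index)
open import Data.Nat.Base as ℕ using (ℕ; zero; suc)
open import Data.Nat.DivMod using (_mod_; m<n⇒m%n≡m; [m+kn]%n≡m%n)
import Data.Nat.Properties as ℕ
open import Data.Product using (Σ; ∃; _×_; _,_; proj₁; proj₂)
open import Data.Rational as ℚ using (ℚ; 0ℚ; 1ℚ)
open import Data.Rational.Solver using (module +-*-Solver)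
import Data.Rational.Properties as ℚ
open import Data.Sum using (_⊎_; inj₁; inj₂)
open import Data.Vec.Functional using (Vector; []; _∷_; head; tail)
open import Function.Base using (_∘_)
open import Function.Bundles using (_⇔_; mk⇔)
open import Function.Metric.Structures using (IsGeneralMetric)
open import Level using (Level; Lift; lift; 0ℓ) renaming (suc to lsuc)
open import Relation.Binary.Bundles using (Poset)
open import Relation.Binary.PropositionalEquality using (_≡_; refl; sym; trans; cong; subst)
open import Relation.Binary.Definitions using (tri<; tri≈; tri>)
open import Relation.Nullary using (¬_; Dec; yes; no)
open import Relation.Unary using (Pred; _∈_; _∩_)
import Relation.Binary.Reasoning.PartialOrder as PartialOrderReasoning
open import Defs
open ℚ-Lemmas

-- Arithmetic, gaps and approximate extrema for the Dedekind reals.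

module RealArithmetic (em : ∀ {ℓ} → ExcludedMiddle ℓ) where

  open Classical em
  open Cut-Lemmas
  open ℝ-Lemmas

  private
    variable
      ℓ : Level

  ≤-poset : Poset 0ℓ 0ℓ 0ℓ
  ≤-poset = record { isPartialOrder = ≤-isPartialOrder }

  open PartialOrderReasoning ≤-poset

  ≤-reflexive : ∀ {x y} → x ≡ y → x ≤ y
  ≤-reflexive refl = ≤-refl

  opaque
    halve : ∀ {ε} → 0ℚ ℚ.< ε → ∃ λ δ → 0ℚ ℚ.< δ × fromℚ δ + fromℚ δ ≤ fromℚ ε
    halve 0<ε = ∃-half (fromℚ-pos 0<ε)

  half≤ : ∀ {δ ε} → 0ℚ ℚ.< δ → fromℚ δ + fromℚ δ ≤ fromℚ ε → fromℚ δ ≤ fromℚ ε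
  half≤ 0<δ 2δ≤ε = ≤-trans (≤+ _ (0≤fromℚ 0<δ)) 2δ≤ε

  ≤-+ε : ∀ {x y ε} → 0ℚ ℚ.< ε → x ≤ y → x ≤ y + fromℚ ε
  ≤-+ε 0<ε x≤y = ≤-trans x≤y (≤+ _ (0≤fromℚ 0<ε))

  ≤-halves : ∀ {x y z δ ε} → fromℚ δ + fromℚ δ ≤ fromℚ ε →
             x ≤ y + fromℚ δ → y ≤ z + fromℚ δ → x ≤ z + fromℚ ε
  ≤-halves {x} {y} {z} {δ} {ε} 2δ≤ε p q = begin
    x                         ≤⟨ p ⟩
    y + fromℚ δ               ≤⟨ +-mono q ≤-refl ⟩
    (z + fromℚ δ) + fromℚ δ   ≤⟨ +-assoc _ _ _ ⟩
    z + (fromℚ δ + fromℚ δ)   ≤⟨ +-mono ≤-refl 2δ≤ε ⟩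
    z + fromℚ ε               ∎

  +-identityʳ-≤ : ∀ x → x + 0ᵣ ≤ x
  +-identityʳ-≤ x = ≤-approx λ 0<ε → +-mono ≤-refl (0≤fromℚ 0<ε)

  +-identityˡ-≤ : ∀ x → 0ᵣ + x ≤ x
  +-identityˡ-≤ x = ≤-trans (+-comm _ _) (+-identityʳ-≤ x)

  +-inverseʳ-≤ : ∀ x → x + (- x) ≤ 0ᵣ
  +-inverseʳ-≤ x = mk λ {q} p →
    let (r , s , r◂x , s◂-x , q<r+s) = +-elim x (- x) p
        (t , s<t , ¬-t◂x) = neg-elim x s◂-x
    in fromℚ-intro 0ℚ (ℚ.<-trans q<r+s (subst (r ℚ.+ s ℚ.<_) (ℚ.+-inverseˡ t)
         (ℚ.+-mono-< (below-bound r◂x ¬-t◂x) s<t)))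

  -- For `q < 0` a point of the cut and one of its complement are needed at distance less than
  -- `- q`. As `x + fromℚ (- q)` exceeds `x`, some `p` lies in the larger cut only, and it is less
  -- than `r - q` for some `r ◂ x`.
  +-inverseʳ-≥ : ∀ x → 0ᵣ ≤ x + (- x)
  +-inverseʳ-≥ x = mk λ {q} q◂0 →
    let 0<-q = ℚ.neg-antimono-< (fromℚ-elim 0ℚ q◂0)
        (p , p◂x-q , ¬p◂x) = gap-point 0<-q
        (r , s , r◂x , s◂-q , p<r+s) = +-elim x (fromℚ (ℚ.- q)) p◂x-q
        p<r-q = ℚ.<-trans p<r+s (ℚ.+-monoʳ-< r (fromℚ-elim (ℚ.- q) s◂-q))
        (t , q-r<t , t<-p) = ℚ.<-dense
          (subst₂′ (move₁ q r p) (move₂ q r p) (ℚ.+-monoˡ-< ((ℚ.- p) ℚ.+ (q ℚ.- r)) p<r-q))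
    in +-intro x (- x) (r , t , r◂x
         , neg-intro x (ℚ.- p , t<-p , subst (λ z → ¬ z ◂ x) (sym (neg-neg p)) ¬p◂x)
         , subst (ℚ._< r ℚ.+ t) (+-minus r q) (ℚ.+-monoʳ-< r q-r<t))
    where
    open +-*-Solver
    subst₂′ : ∀ {a b c d} → a ≡ c → b ≡ d → a ℚ.< b → c ℚ.< d
    subst₂′ refl refl h = h
    move₁ : ∀ q r p → p ℚ.+ ((ℚ.- p) ℚ.+ (q ℚ.- r)) ≡ q ℚ.- r
    move₁ = solve 3 (λ q r p → p :+ ((:- p) :+ (q :- r)) := q :- r) refl
    move₂ : ∀ q r p → (r ℚ.+ (ℚ.- q)) ℚ.+ ((ℚ.- p) ℚ.+ (q ℚ.- r)) ≡ ℚ.- p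
    move₂ = solve 3 (λ q r p → (r :+ (:- q)) :+ ((:- p) :+ (q :- r)) := :- p) refl
    gap-point : ∀ {ε} → 0ℚ ℚ.< ε → ∃ λ p → p ◂ x + fromℚ ε × ¬ p ◂ x
    gap-point 0<ε = by-contradiction λ none →
      <-+ x 0<ε (mk λ {p} p◂x+ε → by-contradiction λ ¬p◂x → none (p , p◂x+ε , ¬p◂x))

  +-inverseˡ-≤ : ∀ x → (- x) + x ≤ 0ᵣ
  +-inverseˡ-≤ x = ≤-trans (+-comm _ _) (+-inverseʳ-≤ x)

  +-inverseˡ-≥ : ∀ x → 0ᵣ ≤ (- x) + x
  +-inverseˡ-≥ x = ≤-trans (+-inverseʳ-≥ x) (+-comm _ _)

  ≤-+⇒-≤ : ∀ {x y z} → x ≤ z + y → x + (- y) ≤ z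
  ≤-+⇒-≤ {x} {y} {z} x≤z+y = begin
    x + (- y)         ≤⟨ +-mono x≤z+y ≤-refl ⟩
    (z + y) + (- y)   ≤⟨ +-assoc _ _ _ ⟩
    z + (y + (- y))   ≤⟨ +-mono ≤-refl (+-inverseʳ-≤ y) ⟩
    z + 0ᵣ            ≤⟨ +-identityʳ-≤ z ⟩
    z                 ∎

  -≤⇒≤-+ : ∀ {x y z} → x + (- y) ≤ z → x ≤ z + y
  -≤⇒≤-+ {x} {y} {z} x-y≤z = begin
    x                 ≤⟨ ≤+ x (+-inverseˡ-≥ y) ⟩
    x + ((- y) + y)   ≤⟨ +-assoc⁻ _ _ _ ⟩
    (x + (- y)) + y   ≤⟨ +-mono x-y≤z ≤-refl ⟩
    z + y             ∎

  +-≤⇒≤- : ∀ {x y z} → x + y ≤ z → x ≤ z + (- y)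
  +-≤⇒≤- {x} {y} {z} x+y≤z = begin
    x                 ≤⟨ ≤+ x (+-inverseʳ-≥ y) ⟩
    x + (y + (- y))   ≤⟨ +-assoc⁻ _ _ _ ⟩
    (x + y) + (- y)   ≤⟨ +-mono x+y≤z ≤-refl ⟩
    z + (- y)         ∎

  ≤-⇒+-≤ : ∀ {x y z} → x ≤ z + (- y) → x + y ≤ z
  ≤-⇒+-≤ {x} {y} {z} x≤z-y = begin
    x + y             ≤⟨ +-mono x≤z-y ≤-refl ⟩
    (z + (- y)) + y   ≤⟨ +-assoc _ _ _ ⟩
    z + ((- y) + y)   ≤⟨ +-mono ≤-refl (+-inverseˡ-≤ y) ⟩
    z + 0ᵣ            ≤⟨ +-identityʳ-≤ z ⟩
    z                 ∎

  opaque
    ∃-gap : ∀ {x y} → x < y → ∃ λ ε → 0ℚ ℚ.< ε × x + fromℚ ε ≤ y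
    ∃-gap {x} {y} x<y =
      let (q , q◂y , ¬q◂x) = separating
          (r , q<r , r◂y) = up q◂y
      in r ℚ.- q , minus-pos q<r , (begin
        x + fromℚ (r ℚ.- q)        ≤⟨ +-mono (mk λ p◂x → fromℚ-intro q (below-bound p◂x ¬q◂x)) ≤-refl ⟩
        fromℚ q + fromℚ (r ℚ.- q)  ≤⟨ fromℚ-+ q (r ℚ.- q) ⟩
        fromℚ (q ℚ.+ (r ℚ.- q))    ≡⟨ cong fromℚ (+-minus q r) ⟩
        fromℚ r                    ≤⟨ ≤-fromℚ r◂y ⟩
        y                          ∎)
      where
      separating : ∃ λ q → q ◂ y × ¬ q ◂ x
      separating = by-contradiction λ none →
        x<y (mk λ {q} q◂y → by-contradiction λ ¬q◂x → none (q , q◂y , ¬q◂x))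

  module _ {I : Set ℓ} {f : I → ℝ} {b : ℝ} where

    opaque
      sup-approx : (∀ i → f i ≤ b) → I → ∀ {ε} → 0ℚ ℚ.< ε → ∃ λ i → sup f ≤ f i + fromℚ ε
      sup-approx f≤b i₀ {ε} 0<ε = by-contradiction λ none → <-+ (sup f) 0<ε
        (≤-⇒+-≤ (sup-≤ i₀ λ i → +-≤⇒≤- (≤-total λ s≤ → none (i , s≤))))

    opaque
      inf-approx : (∀ i → b ≤ f i) → I → ∀ {ε} → 0ℚ ℚ.< ε → ∃ λ i → f i ≤ inf f + fromℚ ε
      inf-approx b≤f i₀ 0<ε = by-contradiction λ none → <-+ (inf f) 0<ε
        (≤-inf b≤f i₀ λ i → ≤-total λ ≤i → none (i , ≤i))

  Within-weaken : ∀ {δ ε x y} → δ ≤ ε → Within δ x y → Within ε x y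
  Within-weaken δ≤ε (a , b) = ≤-trans a (+-mono ≤-refl δ≤ε) , ≤-trans b (+-mono ≤-refl δ≤ε)

  Within-sym : ∀ {ε x y} → Within ε x y → Within ε y x
  Within-sym (a , b) = b , a

  ≈⇒Within : ∀ {ε x y} → 0ℚ ℚ.< ε → x ≈ y → Within (fromℚ ε) x y
  ≈⇒Within 0<ε (a , b) = ≤-+ε 0<ε a , ≤-+ε 0<ε b

  module _ {n} (C : Connective n) where

    opaque
      continuousℚ : ∀ v {ε} → 0ℚ ℚ.< ε → ∃ λ δ → 0ℚ ℚ.< δ ×
                    (∀ w → (∀ i → Within (fromℚ δ) (v i) (w i)) → Within (fromℚ ε) (apply C v) (apply C w))
      continuousℚ v {ε} 0<ε =
        let (δ , 0<δ , near) = Connective.continuous C v (fromℚ ε) (fromℚ-pos 0<ε)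
            (η , 0<η , η≤δ) = ∃-rational-below 0<δ
        in η , 0<η , λ w h → near w λ i → Within-weaken η≤δ (h i)

  ≤⇒minus-≤0 : ∀ {x y} → x ≤ y → x + (- y) ≤ 0ᵣ
  ≤⇒minus-≤0 x≤y = ≤-+⇒-≤ (≤-trans x≤y (≤-trans (≤+ _ ≤-refl) (+-comm _ _)))

  minus-≤0⇒≤ : ∀ {x y} → x + (- y) ≤ 0ᵣ → x ≤ y
  minus-≤0⇒≤ h = ≤-trans (-≤⇒≤-+ h) (+-identityˡ-≤ _)

  ≤-maximum : ∀ {n} (v : Vector ℝ (suc n)) i → v i ≤ maximum v
  ≤-maximum {zero}  v zero    = ≤-refl
  ≤-maximum {suc n} v zero    = max-≤ˡ _ _
  ≤-maximum {suc n} v (suc i) = ≤-trans (≤-maximum (tail v) i) (max-≤ʳ _ _)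

  maximum-≤ : ∀ {n c} (v : Vector ℝ (suc n)) → (∀ i → v i ≤ c) → maximum v ≤ c
  maximum-≤ {zero}  v h = h zero
  maximum-≤ {suc n} v h = max-lub (h zero) (maximum-≤ (tail v) (h ∘ suc))

-- Compactness of boxes and uniform continuity of connectives.

module Compactness (em : ∀ {ℓ} → ExcludedMiddle ℓ) where

  open Classical em
  open ℝ-Lemmas
  open RealArithmetic em

  opaque
    min-upto : ∀ {a} {A : Set a} (r : A → ℚ) → (∀ x → 0ℚ ℚ.< r x) → (xs : List A) →
               ∃ λ η → 0ℚ ℚ.< η × (∀ {x} → x ∈ˡ xs → η ℚ.≤ r x)
    min-upto r 0<r []ˡ       = 1ℚ , ℚ.positive⁻¹ 1ℚ , λ ()
    min-upto r 0<r (x ∷ˡ xs) =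
      let (η , 0<η , η≤) = min-upto r 0<r xs
      in r x ℚ.⊓ η , ⊓-glb-< (0<r x) 0<η , λ
           { (here refl) → ℚ.p⊓q≤p (r x) η
           ; (there x∈xs) → ℚ.≤-trans (ℚ.p⊓q≤q (r x) η) (η≤ x∈xs) }

  upper-bound : ∀ {a} {A : Set a} (f : A → ℝ) (xs : List A) → ∃ λ b → ∀ {x} → x ∈ˡ xs → f x ≤ b
  upper-bound f []ˡ       = 0ᵣ , λ ()
  upper-bound f (x ∷ˡ xs) =
    let (b , f≤b) = upper-bound f xs
    in max (f x) b , λ { (here refl) → max-≤ˡ _ _ ; (there x∈xs) → ≤-trans (f≤b x∈xs) (max-≤ʳ _ _) }

  lower-bound : ∀ {a} {A : Set a} (f : A → ℝ) (xs : List A) → ∃ λ b → ∀ {x} → x ∈ˡ xs → b ≤ f x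
  lower-bound f []ˡ       = 0ᵣ , λ ()
  lower-bound f (x ∷ˡ xs) =
    let (b , b≤f) = lower-bound f xs
    in min (f x) b , λ { (here refl) → min-≤ˡ _ _ ; (there x∈xs) → ≤-trans (min-≤ʳ _ _) (b≤f x∈xs) }

  -- Cousin's lemma: the supremum s of the points z such that [lo , z] is finitely
  -- covered is such a point, and so is s + r s unless it exceeds hi.
  opaque
    interval-cover : ∀ lo hi (r : ℝ → ℚ) → (∀ x → 0ℚ ℚ.< r x) →
      ∃ λ xs → ∀ w → lo ≤ w → w ≤ hi → ∃ λ x → x ∈ˡ xs × Within (fromℚ (r x)) x w
    interval-cover lo hi r 0<r with em {P = lo ≤ hi}
    ... | no lo≰hi  = []ˡ , λ w lo≤w w≤hi → ⊥-elim (lo≰hi (≤-trans lo≤w w≤hi))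
    ... | yes lo≤hi = xs⁺ , whole (min-sel hi s⁺)
      where
      Covered : List ℝ → ℝ → Set
      Covered xs z = ∀ w → lo ≤ w → w ≤ z → ∃ λ x → x ∈ˡ xs × Within (fromℚ (r x)) x w

      Good : Set
      Good = ∃ λ z → z ≤ hi × ∃ λ xs → Covered xs z

      lo-good : Good
      lo-good = lo , lo≤hi , lo ∷ˡ []ˡ , λ w lo≤w w≤lo →
        lo , here refl , ≤-+ε (0<r lo) lo≤w , ≤-+ε (0<r lo) w≤lo

      good≤hi : (g : Good) → proj₁ g ≤ hi
      good≤hi (_ , z≤hi , _) = z≤hi

      s s⁺ : ℝ
      s = sup {I = Good} proj₁
      s⁺ = s + fromℚ (r s)

      near-s : ∃ λ (g : Good) → s ≤ proj₁ g + fromℚ (r s)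
      near-s = sup-approx {f = proj₁} {b = hi} good≤hi lo-good (0<r s)

      z : ℝ
      z = proj₁ (proj₁ near-s)
      xs⁺ : List ℝ
      xs⁺ = s ∷ˡ proj₁ (proj₂ (proj₂ (proj₁ near-s)))

      covered : Covered xs⁺ s⁺
      covered w lo≤w w≤s⁺ = split em
        where
        split : Dec (w ≤ z) → ∃ λ x → x ∈ˡ xs⁺ × Within (fromℚ (r x)) x w
        split (yes w≤z) =
          let (x , x∈xs , near) = proj₂ (proj₂ (proj₂ (proj₁ near-s))) w lo≤w w≤z
          in x , there x∈xs , near
        split (no w≰z)  = s , here refl , ≤-trans (proj₂ near-s) (+-mono (≤-total w≰z) ≤-refl) , w≤s⁺

      whole : hi ≤ min hi s⁺ ⊎ s⁺ ≤ min hi s⁺ → Covered xs⁺ hi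
      whole (inj₁ hi≤) w lo≤w w≤hi = covered w lo≤w (≤-trans w≤hi (≤-trans hi≤ (min-≤ʳ _ _)))
      whole (inj₂ s⁺≤) = ⊥-elim (<-+ s (0<r s) (≤-trans s⁺≤ (≤-sup {f = proj₁} {b = hi} good≤hi
        (min hi s⁺ , min-≤ˡ _ _ , xs⁺ , λ w lo≤w w≤ → covered w lo≤w (≤-trans w≤ (min-≤ʳ _ _))))))

  InBox : ∀ {n} → Vector ℝ n → Vector ℝ n → Vector ℝ n → Set
  InBox lo hi w = ∀ i → lo i ≤ w i × w i ≤ hi i

  opaque
    -- The tube argument: cover the fibre over each `x`, use the least radius in that finite cover
    -- as the gauge at `x`, and cover the first side of the box by intervals.
    box-cover : ∀ {n} (lo hi : Vector ℝ n) (r : Vector ℝ n → ℚ) → (∀ v → 0ℚ ℚ.< r v) →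
      ∃ λ vs → ∀ w → InBox lo hi w → ∃ λ v → v ∈ˡ vs × (∀ i → Within (fromℚ (r v)) (v i) (w i))
    box-cover {zero}  lo hi r 0<r = [] ∷ˡ []ˡ , λ w _ → [] , here refl , λ ()
    box-cover {suc n} lo hi r 0<r = List.concat (List.map slab (proj₁ column)) , λ w w∈box →
      let (x , x∈xs , near-x) = proj₂ column (head w) (proj₁ (w∈box zero)) (proj₂ (w∈box zero))
          (v , v∈vs , near-v) = proj₂ (fibre x) (tail w) (w∈box ∘ suc)
          r≤ = proj₂ (proj₂ (radius x)) v∈vs
      in x ∷ v , ∈-concat⁺′ (∈-map⁺ (x ∷_) v∈vs) (∈-map⁺ slab x∈xs) ,
         λ { zero → Within-weaken (fromℚ-mono r≤) near-x ; (suc i) → near-v i }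
      where
      fibre : ∀ x → ∃ λ vs → ∀ w → InBox (tail lo) (tail hi) w →
              ∃ λ v → v ∈ˡ vs × (∀ i → Within (fromℚ (r (x ∷ v))) (v i) (w i))
      fibre x = box-cover (tail lo) (tail hi) (λ v → r (x ∷ v)) (λ v → 0<r (x ∷ v))
      radius : ∀ x → ∃ λ η → 0ℚ ℚ.< η × (∀ {v} → v ∈ˡ proj₁ (fibre x) → η ℚ.≤ r (x ∷ v))
      radius x = min-upto (λ v → r (x ∷ v)) (λ v → 0<r (x ∷ v)) (proj₁ (fibre x))
      column : ∃ λ xs → ∀ w → head lo ≤ w → w ≤ head hi →
               ∃ λ x → x ∈ˡ xs × Within (fromℚ (proj₁ (radius x))) x w
      column = interval-cover (head lo) (head hi) (λ x → proj₁ (radius x)) (λ x → proj₁ (proj₂ (radius x)))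
      slab : ℝ → List (Vector ℝ (suc n))
      slab x = List.map (x ∷_) (proj₁ (fibre x))

  module _ {n} (C : Connective n) (lo hi : Vector ℝ n) where

    opaque
      -- Lebesgue numbers: with `c` the centre of a covering ball around `w`, both `v` and `w` lie
      -- within the modulus of continuity at `c`. Only `w` has to be in the box.
      uniformly-continuous : ∀ {ε} → 0ℚ ℚ.< ε → ∃ λ η → 0ℚ ℚ.< η ×
        (∀ v w → InBox lo hi w → (∀ i → Within (fromℚ η) (v i) (w i)) → apply C v ≤ apply C w + fromℚ ε)
      uniformly-continuous {ε} 0<ε =
        let (η , 0<η , η≤) = min-upto radius 0<radius (proj₁ cover)
        in η , 0<η , λ v w w∈box v≈w →
          let (c , c∈cs , c≈w) = proj₂ cover w w∈box
              r≤ = fromℚ-mono (η≤ c∈cs)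
              (_ , _ , 2r≤) = halve (proj₁ (proj₂ (modulus c)))
          in ≤-halves 2ε′≤ε
               (proj₂ (near c v λ i →
                 ≤-halves 2r≤ (proj₁ (c≈w i)) (≤-trans (proj₂ (v≈w i)) (+-mono ≤-refl r≤)) ,
                 ≤-halves 2r≤ (≤-trans (proj₁ (v≈w i)) (+-mono ≤-refl r≤)) (proj₂ (c≈w i))))
               (proj₁ (near c w λ i → Within-weaken (half≤ (0<radius c) 2r≤) (c≈w i)))
        where
        ε′ : ℚ
        ε′ = proj₁ (halve 0<ε)
        0<ε′ : 0ℚ ℚ.< ε′
        0<ε′ = proj₁ (proj₂ (halve 0<ε))
        2ε′≤ε : fromℚ ε′ + fromℚ ε′ ≤ fromℚ ε
        2ε′≤ε = proj₂ (proj₂ (halve 0<ε))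
        modulus : ∀ c → ∃ λ δ → 0ℚ ℚ.< δ × (∀ w → (∀ i → Within (fromℚ δ) (c i) (w i)) →
                  Within (fromℚ ε′) (apply C c) (apply C w))
        modulus c = continuousℚ C c 0<ε′
        near : ∀ c w → (∀ i → Within (fromℚ (proj₁ (modulus c))) (c i) (w i)) →
               Within (fromℚ ε′) (apply C c) (apply C w)
        near c = proj₂ (proj₂ (modulus c))
        -- Half the modulus at `c`, so that a ball of this radius can be enlarged by `η` without
        -- leaving the region controlled at `c`.
        radius : Vector ℝ n → ℚ
        radius c = proj₁ (halve (proj₁ (proj₂ (modulus c))))
        0<radius : ∀ c → 0ℚ ℚ.< radius c
        0<radius c = proj₁ (proj₂ (halve (proj₁ (proj₂ (modulus c)))))
        cover : ∃ λ vs → ∀ w → InBox lo hi w →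
                ∃ λ v → v ∈ˡ vs × (∀ i → Within (fromℚ (radius v)) (v i) (w i))
        cover = box-cover lo hi radius 0<radius

    opaque
      -- Finitely many balls on which `C` varies by at most `1` cover the box, so the values at
      -- their centres, moved by `1`, bound it.
      bounded-on-box : ∃ λ b → ∃ λ c → ∀ w → InBox lo hi w → b ≤ apply C w × apply C w ≤ c
      bounded-on-box =
        let (b , b≤) = lower-bound (λ v → apply C v + (- one)) (proj₁ cover)
            (c , ≤c) = upper-bound (λ v → apply C v + one) (proj₁ cover)
        in b , c , λ w w∈box →
          let (v , v∈vs , v≈w) = proj₂ cover w w∈box
              (v≤w , w≤v) = proj₂ (proj₂ (modulus v)) w v≈w
          in ≤-trans (b≤ v∈vs) (≤-+⇒-≤ v≤w) , ≤-trans w≤v (≤c v∈vs)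
        where
        one : ℝ
        one = fromℚ 1ℚ
        modulus : ∀ v → ∃ λ δ → 0ℚ ℚ.< δ × (∀ w → (∀ i → Within (fromℚ δ) (v i) (w i)) →
                  Within one (apply C v) (apply C w))
        modulus v = continuousℚ C v (ℚ.positive⁻¹ 1ℚ)
        cover : ∃ λ vs → ∀ w → InBox lo hi w →
                ∃ λ v → v ∈ˡ vs × (∀ i → Within (fromℚ (proj₁ (modulus v))) (v i) (w i))
        cover = box-cover lo hi (λ v → proj₁ (modulus v)) (λ v → proj₁ (proj₂ (modulus v)))

-- Bounds for formulas, blocks of quantifiers, and SCP in terms of points.

module FormulaLemmas (em : ∀ {ℓ} → ExcludedMiddle ℓ) (ext : ∀ {a b} → Extensionality a b) where

  open Classical em
  open ℝ-Lemmas
  open RealArithmetic em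
  open Compactness em
  open Structure using (Carrier)

  ∷-η : ∀ {a n} {A : Set a} (v : Vector A (suc n)) → head v ∷ tail v ≡ v
  ∷-η v = ext λ { zero → refl ; (suc i) → refl }

  []-η : ∀ {a} {A : Set a} (v : Vector A 0) → v ≡ []
  []-η v = ext λ ()

  prepend : ∀ {a k m} {A : Set a} → Vector A k → Vector A m → Vector A (k ℕ.+ m)
  prepend {k = zero}  a b = b
  prepend {k = suc k} a b = head a ∷ prepend (tail a) b

  module _ {ℓ} {L : Signature ℓ} where

    open Signature L

    opaque
      -- Uniformity in `M` and `ρ` matters twice: it keeps `sup` and `inf` off their junk value, and
      -- it confines the arguments of a connective to one box for all structures.
      bounds : ∀ {n} (θ : Formula L n) →
               ∃ λ lo → ∃ λ hi → ∀ M ρ → lo ≤ ⟦ M ⟧ θ ρ × ⟦ M ⟧ θ ρ ≤ hi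
      bounds (dist s t)  = 0ᵣ , diameter , λ M ρ →
        IsGeneralMetric.nonNegative (Structure.isMetric M) , Structure.bounded M _ _
      bounds (atom p ts) = predLower p , predUpper p , λ M ρ →
        Structure.pred-lower M p _ , Structure.pred-upper M p _
      bounds (conn C φs) =
        let (b , c , h) = bounded-on-box C (λ i → proj₁ (bounds (φs i)))
                                           (λ i → proj₁ (proj₂ (bounds (φs i))))
        in b , c , λ M ρ → h _ λ i → proj₂ (proj₂ (bounds (φs i))) M ρ
      bounds (Inf φ) =
        let (lo , hi , h) = bounds φ
        in lo , hi , λ M ρ →
          ≤-inf (λ a → proj₁ (h M (a ∷ ρ))) (Structure.nonempty M) (λ a → proj₁ (h M (a ∷ ρ))) ,
          ≤-trans (inf-≤ (λ a → proj₁ (h M (a ∷ ρ))) (Structure.nonempty M)) (proj₂ (h M _))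
      bounds (Sup φ) =
        let (lo , hi , h) = bounds φ
        in lo , hi , λ M ρ →
          ≤-trans (proj₁ (h M _)) (≤-sup (λ a → proj₂ (h M (a ∷ ρ))) (Structure.nonempty M)) ,
          sup-≤ (Structure.nonempty M) (λ a → proj₂ (h M (a ∷ ρ)))

    module _ (M : Structure L) {n} (θ : Formula L (suc n)) (ρ : Vector (Carrier M) n) where

      private
        lower : ∀ a → proj₁ (bounds θ) ≤ ⟦ M ⟧ θ (a ∷ ρ)
        lower a = proj₁ (proj₂ (proj₂ (bounds θ)) M (a ∷ ρ))
        upper : ∀ a → ⟦ M ⟧ θ (a ∷ ρ) ≤ proj₁ (proj₂ (bounds θ))
        upper a = proj₂ (proj₂ (proj₂ (bounds θ)) M (a ∷ ρ))

      Inf-≤ : ∀ a → ⟦ M ⟧ (Inf θ) ρ ≤ ⟦ M ⟧ θ (a ∷ ρ)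
      Inf-≤ = inf-≤ lower

      Inf-approx : ∀ {ε} → 0ℚ ℚ.< ε → ∃ λ a → ⟦ M ⟧ θ (a ∷ ρ) ≤ ⟦ M ⟧ (Inf θ) ρ + fromℚ ε
      Inf-approx = inf-approx lower (Structure.nonempty M)

      ≤-Sup : ∀ a → ⟦ M ⟧ θ (a ∷ ρ) ≤ ⟦ M ⟧ (Sup θ) ρ
      ≤-Sup = ≤-sup upper

      Sup-≤ : ∀ {c} → (∀ a → ⟦ M ⟧ θ (a ∷ ρ) ≤ c) → ⟦ M ⟧ (Sup θ) ρ ≤ c
      Sup-≤ = sup-≤ (Structure.nonempty M)

      Sup-approx : ∀ {ε} → 0ℚ ℚ.< ε → ∃ λ a → ⟦ M ⟧ (Sup θ) ρ ≤ ⟦ M ⟧ θ (a ∷ ρ) + fromℚ ε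
      Sup-approx = sup-approx upper (Structure.nonempty M)

    module _ (M : Structure L) {m} (b : Vector (Carrier M) m) where

      infs-≤ : ∀ {k} (θ : Formula L (k ℕ.+ m)) a → ⟦ M ⟧ (infs k θ) b ≤ ⟦ M ⟧ θ (prepend a b)
      infs-≤ {zero}  θ a = ≤-refl
      infs-≤ {suc k} θ a = ≤-trans (infs-≤ (Inf θ) (tail a)) (Inf-≤ M θ _ (head a))

      infs-approx : ∀ {k} (θ : Formula L (k ℕ.+ m)) {ε} → 0ℚ ℚ.< ε →
                    ∃ λ a → ⟦ M ⟧ θ (prepend a b) ≤ ⟦ M ⟧ (infs k θ) b + fromℚ ε
      infs-approx {zero}  θ 0<ε = [] , ≤-+ε 0<ε ≤-refl
      infs-approx {suc k} θ 0<ε =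
        let (δ , 0<δ , 2δ≤ε) = halve 0<ε
            (a , near) = infs-approx (Inf θ) 0<δ
            (x , near-x) = Inf-approx M θ (prepend a b) 0<δ
        in x ∷ a , ≤-halves 2δ≤ε near-x near

    module _ (M : Structure L) {c : ℝ} where

      sups-≤ : ∀ {m} (θ : Formula L m) → (∀ b → ⟦ M ⟧ θ b ≤ c) → ⟦ M ⟧ (sups m θ) [] ≤ c
      sups-≤ {zero}  θ h = h []
      sups-≤ {suc m} θ h = sups-≤ (Sup θ) λ b → Sup-≤ M θ b λ x → h (x ∷ b)

      sups-≤⁻ : ∀ {m} (θ : Formula L m) → ⟦ M ⟧ (sups m θ) [] ≤ c → ∀ b → ⟦ M ⟧ θ b ≤ c
      sups-≤⁻ {zero}  θ h b = subst (λ b → ⟦ M ⟧ θ b ≤ c) (sym ([]-η b)) h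
      sups-≤⁻ {suc m} θ h b = subst (λ b → ⟦ M ⟧ θ b ≤ c) (∷-η b)
        (≤-trans (≤-Sup M θ (tail b) (head b)) (sups-≤⁻ (Sup θ) h (tail b)))

    -- The evaluated argument vector is a function that agrees with the literal one only pointwise,
    -- hence `ext`.
    $-value : ∀ (M : Structure L) C {n} (φ : Formula L n) ρ →
              ⟦ M ⟧ (C $ φ) ρ ≡ apply C (⟦ M ⟧ φ ρ ∷ [])
    $-value M C φ ρ = cong (apply C) (ext λ { zero → refl })

    ≤-maxᶠ : ∀ (M : Structure L) {n m} (φs : Vector (Formula L m) (suc n)) ρ j →
             ⟦ M ⟧ (φs j) ρ ≤ ⟦ M ⟧ (conn maxᶜ φs) ρ
    ≤-maxᶠ M φs ρ = ≤-maximum (λ j → ⟦ M ⟧ (φs j) ρ)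

    maxᶠ-≤ : ∀ (M : Structure L) {n m} (φs : Vector (Formula L m) (suc n)) ρ {c} →
             (∀ j → ⟦ M ⟧ (φs j) ρ ≤ c) → ⟦ M ⟧ (conn maxᶜ φs) ρ ≤ c
    maxᶠ-≤ M φs ρ = maximum-≤ (λ j → ⟦ M ⟧ (φs j) ρ)

    -- The elementwise form of SCP: points with φ and one D j $ ψ j small can be
    -- traded for a single point where φ and all D j $ ψ j are small.
    Amalgamates : Structure L → Set ℓ
    Amalgamates M =
      ∀ {n} k m {φ : Formula L (k ℕ.+ m)} {ψ : Vector (Formula L (k ℕ.+ m)) (suc (suc n))}
      (D : Vector (Connective 1) (suc (suc n))) →
      Palyutin φ → (∀ j → Palyutin (ψ j)) → (∀ j → Nonincreasing (D j)) →
      ∀ (b : Vector (Carrier M) m) {c ε} → 0ℚ ℚ.< ε →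
      (∀ j → ∃ λ a → ⟦ M ⟧ φ (prepend a b) ≤ c × ⟦ M ⟧ (D j $ ψ j) (prepend a b) ≤ c) →
      ∃ λ (a : Vector (Carrier M) k) → ⟦ M ⟧ φ (prepend a b) ≤ c + fromℚ ε ×
        (∀ j → ⟦ M ⟧ (D j $ ψ j) (prepend a b) ≤ c + fromℚ ε)

    -- SCP bounds the infimum of the joint maximum by `c`; a near minimizer of it is the required
    -- point, and `ε` is what it misses.
    ⊨SCP⇒amalgamates : ∀ {M} → M ⊨ SCP L → Amalgamates M
    ⊨SCP⇒amalgamates {M} M⊨ k m {φ} {ψ} D Pφ Pψ D↓ b {c} {ε} 0<ε h =
      let (a , near) = infs-approx M b (conn maxᶜ all) 0<ε
          below = λ j → ≤-trans (≤-maxᶠ M all (prepend a b) j) (≤-trans near (+-mono inf≤c ≤-refl))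
      in a , below zero , λ j → below (suc j)
      where
      all : Vector (Formula L (k ℕ.+ m)) _
      all = φ ∷ λ j → D j $ ψ j
      single : Vector (Formula L m) _
      single j = infs k (max₂ φ (D j $ ψ j))
      inf≤c : ⟦ M ⟧ (infs k (conn maxᶜ all)) b ≤ c
      inf≤c = ≤-trans (minus-≤0⇒≤ (sups-≤⁻ M
        (conn differenceᶜ (infs k (conn maxᶜ all) ∷ conn maxᶜ single ∷ []))
        (M⊨ (scp {k = k} {m} D Pφ Pψ D↓)) b))
        (maxᶠ-≤ M single b λ j → let (a , φ≤c , Dψ≤c) = h j in
          ≤-trans (infs-≤ M b (max₂ φ (D j $ ψ j)) a) (max-lub φ≤c Dψ≤c))

    amalgamates⇒⊨SCP : ∀ {M} → Amalgamates M → M ⊨ SCP L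
    amalgamates⇒⊨SCP {M} am (scp {n} {k} {m} {φ} {ψ} D Pφ Pψ D↓) =
      sups-≤ M (conn differenceᶜ (infs k (conn maxᶜ all) ∷ conn maxᶜ single ∷ [])) λ b → ≤⇒minus-≤0 (≤-approx λ 0<ε →
        let (δ , 0<δ , 2δ≤ε) = halve 0<ε
            -- The bound to amalgamate at is the maximum of the single infima plus `δ`, the `δ`
            -- paying for near minimizers of each; amalgamation costs the second `δ`.
            (a , φ≤ , Dψ≤) = am k m D Pφ Pψ D↓ b 0<δ (near b 0<δ)
        in ≤-halves 2δ≤ε
             (≤-trans (infs-≤ M b (conn maxᶜ all) a)
                      (maxᶠ-≤ M all (prepend a b) λ { zero → φ≤ ; (suc j) → Dψ≤ j }))
             ≤-refl)
      where
      all : Vector (Formula L (k ℕ.+ m)) _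
      all = φ ∷ λ j → D j $ ψ j
      single : Vector (Formula L m) _
      single j = infs k (max₂ φ (D j $ ψ j))
      near : ∀ b {δ} → 0ℚ ℚ.< δ → ∀ j → ∃ λ a →
             ⟦ M ⟧ φ (prepend a b) ≤ ⟦ M ⟧ (conn maxᶜ single) b + fromℚ δ ×
             ⟦ M ⟧ (D j $ ψ j) (prepend a b) ≤ ⟦ M ⟧ (conn maxᶜ single) b + fromℚ δ
      near b 0<δ j =
        let (a , near-a) = infs-approx M b (max₂ φ (D j $ ψ j)) 0<δ
            below = ≤-trans near-a (+-mono (≤-maxᶠ M single b j) ≤-refl)
        in a , ≤-trans (max-≤ˡ _ _) below , ≤-trans (max-≤ʳ _ _) below

-- Limits superior along a filter and their behaviour under connectives.

module PalyutinProducts (em : ∀ {ℓ} → ExcludedMiddle ℓ) (ext : ∀ {a b} → Extensionality a b) where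

  open Classical em hiding (δ)
  open ℝ-Lemmas
  open Connective-Lemmas
  open RealArithmetic em
  open FormulaLemmas em ext
  open Structure using (Carrier)

  module _ {ℓ} {I : Set ℓ} (F : Filter I) where

    open Limsup-Lemmas F

    -- `eventually` says that `l` is at least the limit superior and `frequently` that it is at most
    -- that. Stated with errors, the two halves pass through quantifiers by choosing approximate
    -- witnesses.
    record IsLimsup (u : I → ℝ) (l : ℝ) : Set (lsuc ℓ) where
      field
        eventually : ∀ {ε} → 0ℚ ℚ.< ε → ∃ λ J → J ∈ sets F × (∀ i → i ∈ J → u i ≤ l + fromℚ ε)
        frequently : ∀ {ε} → 0ℚ ℚ.< ε → ∀ {J} → J ∈ sets F → ∃ λ i → i ∈ J × l ≤ u i + fromℚ ε

    open IsLimsup public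

    limsup-isLimsup : ∀ {u lo hi} → (∀ i → lo ≤ u i) → (∀ i → u i ≤ hi) → IsLimsup u (limsup F u)
    limsup-isLimsup lo≤u u≤hi = record
      { eventually = limsup-≤⁻ lo≤u u≤hi ≤-refl
      ; frequently = λ 0<ε J∈F → by-contradiction λ none → <-+ _ 0<ε
          (≤-⇒+-≤ (limsup-≤ lo≤u u≤hi J∈F λ i i∈J → +-≤⇒≤- (≤-total λ l≤ → none (i , i∈J , l≤))))
      }

    module _ {u l} (lim : IsLimsup u l) where

      limit-≤ : ∀ {c J} → J ∈ sets F → (∀ i → i ∈ J → u i ≤ c) → l ≤ c
      limit-≤ J∈F u≤c = ≤-approx λ 0<ε →
        let (i , i∈J , l≤u) = frequently lim 0<ε J∈F in ≤-trans l≤u (+-mono (u≤c i i∈J) ≤-refl)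

      ≤-limit : ∀ {c} → (∀ {J} → J ∈ sets F → ∃ λ i → i ∈ J × c ≤ u i) → c ≤ l
      ≤-limit c≤u = ≤-approx λ 0<ε →
        let (J , J∈F , u≤l) = eventually lim 0<ε
            (i , i∈J , c≤ui) = c≤u J∈F
        in ≤-trans c≤ui (u≤l i i∈J)

      module _ (C : Connective 1) where

        private
          C₁ : ℝ → ℝ
          C₁ x = apply C (x ∷ [])

          -- Eventually `u i` is at most `l + δ`, but it may be far below `l`. Truncation at `l`
          -- brings it within reach of continuity there, and monotonicity compares it with its
          -- truncation. `near-min` is the mirror image.
          near-max : ∀ {ε} → 0ℚ ℚ.< ε → ∃ λ J → J ∈ sets F ×
                     (∀ i → i ∈ J → Within (fromℚ ε) (C₁ l) (C₁ (max l (u i))))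
          near-max 0<ε =
            let (δ , 0<δ , near) = continuousℚ C (l ∷ []) 0<ε
                (J , J∈F , u≤l) = eventually lim 0<δ
            in J , J∈F , λ i i∈J → near (max l (u i) ∷ []) λ { zero →
                 ≤-+ε 0<δ (max-≤ˡ _ _) , max-lub (≤-+ε 0<δ ≤-refl) (u≤l i i∈J) }

          near-min : ∀ {ε} → 0ℚ ℚ.< ε → ∀ {J} → J ∈ sets F →
                     ∃ λ i → i ∈ J × Within (fromℚ ε) (C₁ l) (C₁ (min l (u i)))
          near-min 0<ε J∈F =
            let (δ , 0<δ , near) = continuousℚ C (l ∷ []) 0<ε
                (i , i∈J , l≤u) = frequently lim 0<δ J∈F
            in i , i∈J , near (min l (u i) ∷ []) λ { zero →
                 ≤-trans (min-glb (≤-+ε 0<δ ≤-refl) l≤u) (min-+ l (u i)) , ≤-+ε 0<δ (min-≤ˡ _ _) }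
            where
            min-+ : ∀ x y {z} → min (x + z) (y + z) ≤ min x y + z
            min-+ x y = min-shift ≤-refl ≤-refl

        nondecreasing-isLimsup : Nondecreasing C →
          IsLimsup (λ i → apply C (u i ∷ [])) (apply C (l ∷ []))
        nondecreasing-isLimsup C↑ = record
          { eventually = λ 0<ε →
              let (J , J∈F , near) = near-max 0<ε
              in J , J∈F , λ i i∈J → ≤-trans (C↑ _ _ (max-≤ʳ _ _)) (proj₂ (near i i∈J))
          ; frequently = λ 0<ε J∈F →
              let (i , i∈J , near) = near-min 0<ε J∈F
              in i , i∈J , ≤-trans (proj₁ near) (+-mono (C↑ _ _ (min-≤ʳ _ _)) ≤-refl)
          }

        -- A nonincreasing connective turns the limit superior into a limit inferior; this lemma and
        -- the next are its two halves.
        nonincreasing-eventually : Nonincreasing C → ∀ {ε} → 0ℚ ℚ.< ε →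
          ∃ λ J → J ∈ sets F × (∀ i → i ∈ J → apply C (l ∷ []) ≤ apply C (u i ∷ []) + fromℚ ε)
        nonincreasing-eventually C↓ 0<ε =
          let (J , J∈F , near) = near-max 0<ε
          in J , J∈F , λ i i∈J → ≤-trans (proj₁ (near i i∈J)) (+-mono (C↓ _ _ (max-≤ʳ _ _)) ≤-refl)

        nonincreasing-frequently : Nonincreasing C → ∀ {ε} → 0ℚ ℚ.< ε → ∀ {J} → J ∈ sets F →
          ∃ λ i → i ∈ J × apply C (u i ∷ []) ≤ apply C (l ∷ []) + fromℚ ε
        nonincreasing-frequently C↓ 0<ε J∈F =
          let (i , i∈J , near) = near-min 0<ε J∈F
          in i , i∈J , ≤-trans (C↓ _ _ (min-≤ʳ _ _)) (proj₂ near)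

    -- For the second half the larger of `l` and `m` suffices, and it is approached frequently by
    -- its own family; no index has to serve both.
    max-isLimsup : ∀ {u v l m} → IsLimsup u l → IsLimsup v m →
                   IsLimsup (λ i → max (u i) (v i)) (max l m)
    max-isLimsup {u} {v} {l} {m} l-lim m-lim = record
      { eventually = λ 0<ε →
          let (J , J∈F , u≤l) = eventually l-lim 0<ε
              (K , K∈F , v≤m) = eventually m-lim 0<ε
          in J ∩ K , Filter.meet F J∈F K∈F , λ i (i∈J , i∈K) → max-shift (u≤l i i∈J) (v≤m i i∈K)
      ; frequently = λ 0<ε J∈F → pick em 0<ε J∈F
      }
      where
      pick : Dec (l ≤ m) → ∀ {ε} → 0ℚ ℚ.< ε → ∀ {J} → J ∈ sets F →
             ∃ λ i → i ∈ J × max l m ≤ max (u i) (v i) + fromℚ ε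
      pick (yes l≤m) 0<ε J∈F =
        let (i , i∈J , m≤v) = frequently m-lim 0<ε J∈F
        in i , i∈J , ≤-trans (max-lub l≤m ≤-refl) (≤-trans m≤v (+-mono (max-≤ʳ _ _) ≤-refl))
      pick (no l≰m) 0<ε J∈F =
        let (i , i∈J , l≤u) = frequently l-lim 0<ε J∈F
        in i , i∈J , ≤-trans (max-lub ≤-refl (≤-total l≰m)) (≤-trans l≤u (+-mono (max-≤ˡ _ _) ≤-refl))

  -- Values of Palyutin formulas in reduced products.

  module _ {ℓ} {L : Signature ℓ} {I : Set ℓ} (M : I → Structure L) (F : Filter I) where

    Mꟳ : Structure L
    Mꟳ = reducedProduct M F

    at : ∀ {n} → Vector (Carrier Mꟳ) n → ∀ i → Vector (Carrier (M i)) n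
    at a i k = a k i

    at-∷ : ∀ {n} x (a : Vector (Carrier Mꟳ) n) i → at (x ∷ a) i ≡ x i ∷ at a i
    at-∷ x a i = ext λ { zero → refl ; (suc k) → refl }

    at-prepend : ∀ {k m} (a : Vector (Carrier Mꟳ) k) (b : Vector (Carrier Mꟳ) m) i →
                 at (prepend a b) i ≡ prepend (at a i) (at b i)
    at-prepend {zero}  a b i = refl
    at-prepend {suc k} a b i = trans (at-∷ (head a) (prepend (tail a) b) i)
      (cong (head a i ∷_) (at-prepend (tail a) b i))

    term-at : ∀ {n} (t : Term L n) a i → ⟦ Mꟳ ⟧ᵗ t a i ≡ ⟦ M i ⟧ᵗ t (at a i)
    term-at (var x)    a i = refl
    term-at (app f ts) a i = cong (Structure.fun (M i) f) (ext λ k → term-at (ts k) a i)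

    -- Łoś's theorem for φ, with limit superior in place of truth on a large set.
    Continuous : ∀ {n} → Formula L n → Set (lsuc ℓ)
    Continuous φ = ∀ a → IsLimsup F (λ i → ⟦ M i ⟧ φ (at a i)) (⟦ Mꟳ ⟧ φ a)

    continuous-∷ : ∀ {n} (φ : Formula L (suc n)) → Continuous φ → ∀ x a →
                   IsLimsup F (λ i → ⟦ M i ⟧ φ (x i ∷ at a i)) (⟦ Mꟳ ⟧ φ (x ∷ a))
    continuous-∷ φ φ-lim x a = subst (λ u → IsLimsup F u (⟦ Mꟳ ⟧ φ (x ∷ a)))
      (ext λ i → cong (⟦ M i ⟧ φ) (at-∷ x a i)) (φ-lim (x ∷ a))

    dist-continuous : ∀ {n} (s t : Term L n) → Continuous (dist s t)
    dist-continuous s t a = subst (λ u → IsLimsup F u (⟦ Mꟳ ⟧ (dist s t) a))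
      (ext λ i → trans (cong (λ x → Structure.d (M i) x _) (term-at s a i))
                       (cong (Structure.d (M i) _) (term-at t a i)))
      (limsup-isLimsup F (λ i → IsGeneralMetric.nonNegative (Structure.isMetric (M i)))
                         (λ i → Structure.bounded (M i) _ _))

    atom-continuous : ∀ {n} p (ts : Vector (Term L n) _) → Continuous (atom p ts)
    atom-continuous p ts a = subst (λ u → IsLimsup F u (⟦ Mꟳ ⟧ (atom p ts) a))
      (ext λ i → cong (Structure.pred (M i) p) (ext λ k → term-at (ts k) a i))
      (limsup-isLimsup F (λ i → Structure.pred-lower (M i) p _) (λ i → Structure.pred-upper (M i) p _))

    mono-continuous : ∀ {n} {φ : Formula L n} (C : Connective 1) → Nondecreasing C →
                      Continuous φ → Continuous (C $ φ)
    mono-continuous {φ = φ} C C↑ φ-lim a =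
      subst (IsLimsup F _) (sym ($-value Mꟳ C φ a))
        (subst (λ u → IsLimsup F u (apply C (⟦ Mꟳ ⟧ φ a ∷ []))) (ext λ i → sym ($-value (M i) C φ (at a i)))
          (nondecreasing-isLimsup F (φ-lim a) C C↑))

    module _ {n} (φ : Formula L (suc n)) (φ-lim : Continuous φ) (a : Vector (Carrier Mꟳ) n) where

      -- A near minimizer in the product projects to every factor, and near minimizers chosen in the
      -- factors form an element of the product. `Sup-isLimsup` exchanges the two directions.
      Inf-isLimsup : IsLimsup F (λ i → ⟦ M i ⟧ (Inf φ) (at a i)) (⟦ Mꟳ ⟧ (Inf φ) a)
      Inf-isLimsup = record
        { eventually = λ 0<ε →
            let (δ , 0<δ , 2δ≤ε) = halve 0<ε
                (x , φx≤) = Inf-approx Mꟳ φ a 0<δ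
                (J , J∈F , φ≤) = eventually (continuous-∷ φ φ-lim x a) 0<δ
            in J , J∈F , λ i i∈J →
                 ≤-trans (Inf-≤ (M i) φ (at a i) (x i)) (≤-halves 2δ≤ε (φ≤ i i∈J) φx≤)
        ; frequently = λ 0<ε J∈F →
            let (δ , 0<δ , 2δ≤ε) = halve 0<ε
                near = λ i → Inf-approx (M i) φ (at a i) 0<δ
                x = λ i → proj₁ (near i)
                (i , i∈J , φ≤) = frequently (continuous-∷ φ φ-lim x a) 0<δ J∈F
            in i , i∈J , ≤-trans (Inf-≤ Mꟳ φ a x) (≤-halves 2δ≤ε φ≤ (proj₂ (near i)))
        }

      Sup-isLimsup : IsLimsup F (λ i → ⟦ M i ⟧ (Sup φ) (at a i)) (⟦ Mꟳ ⟧ (Sup φ) a)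
      Sup-isLimsup = record
        { eventually = λ 0<ε →
            let (δ , 0<δ , 2δ≤ε) = halve 0<ε
                near = λ i → Sup-approx (M i) φ (at a i) 0<δ
                x = λ i → proj₁ (near i)
                (J , J∈F , φ≤) = eventually (continuous-∷ φ φ-lim x a) 0<δ
            in J , J∈F , λ i i∈J → ≤-halves 2δ≤ε (proj₂ (near i))
                 (≤-trans (φ≤ i i∈J) (+-mono (≤-Sup Mꟳ φ a x) ≤-refl))
        ; frequently = λ 0<ε J∈F →
            let (δ , 0<δ , 2δ≤ε) = halve 0<ε
                (x , ≤φx) = Sup-approx Mꟳ φ a 0<δ
                (i , i∈J , φ≤) = frequently (continuous-∷ φ φ-lim x a) 0<δ J∈F
            in i , i∈J , ≤-halves 2δ≤ε ≤φx
                 (≤-trans φ≤ (+-mono (≤-Sup (M i) φ (at a i) (x i)) ≤-refl))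
        }

    module MaxInfSup {n} (φ ψ : Formula L (suc n)) (D : Connective 1) (Δ : ℝ) (D↓ : Nonincreasing D)
                     (fixed : apply D (Δ ∷ []) ≈ Δ) (φ-lim : Continuous φ) (ψ-lim : Continuous ψ)
                     (a : Vector (Carrier Mꟳ) n) where

      θ : Formula L (suc n)
      θ = conn minᶜ ((D $ φ) ∷ conn (constᶜ Δ) [] ∷ ψ ∷ [])

      χ : Formula L n
      χ = max₂ (Inf φ) (Sup θ)

      D₁ : ℝ → ℝ
      D₁ x = apply D (x ∷ [])

      θ-≤Δ : ∀ (N : Structure L) ρ → ⟦ N ⟧ θ ρ ≤ Δ
      θ-≤Δ N ρ = ≤-trans (min-≤ʳ _ _) (min-≤ˡ _ _)

      θ-≤ψ : ∀ (N : Structure L) ρ → ⟦ N ⟧ θ ρ ≤ ⟦ N ⟧ ψ ρ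
      θ-≤ψ N ρ = ≤-trans (min-≤ʳ _ _) (min-≤ʳ _ _)

      θ-≤D : ∀ (N : Structure L) ρ → ⟦ N ⟧ θ ρ ≤ D₁ (⟦ N ⟧ φ ρ)
      θ-≤D N ρ = ≤-trans (min-≤ˡ _ _) (≤-reflexive ($-value N D φ ρ))

      θ-glb : ∀ (N : Structure L) ρ {c} → c ≤ D₁ (⟦ N ⟧ φ ρ) → c ≤ Δ → c ≤ ⟦ N ⟧ ψ ρ → c ≤ ⟦ N ⟧ θ ρ
      θ-glb N ρ c≤D c≤Δ c≤ψ =
        min-glb (≤-trans c≤D (≤-reflexive (sym ($-value N D φ ρ)))) (min-glb c≤Δ c≤ψ)

      l : ℝ
      l = ⟦ Mꟳ ⟧ χ a

      inf≤l : ⟦ Mꟳ ⟧ (Inf φ) a ≤ l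
      inf≤l = max-≤ˡ _ _

      -- If χ exceeded thr = l + η frequently, the product of points with θ ≥ thr
      -- where they exist, and of near minimizers of φ elsewhere, would make θ at
      -- least thr in the reduced product: at a near minimizer D φ ≥ D Δ = Δ ≥ thr.
      module Exceeding {η} (0<η : 0ℚ ℚ.< η) (thr≤Δ : l + fromℚ η ≤ Δ) where

        thr : ℝ
        thr = l + fromℚ η

        δ : ℚ
        δ = proj₁ (halve 0<η)
        0<δ : 0ℚ ℚ.< δ
        0<δ = proj₁ (proj₂ (halve 0<η))
        2δ≤η : fromℚ δ + fromℚ δ ≤ fromℚ η
        2δ≤η = proj₂ (proj₂ (halve 0<η))

        High : I → Set ℓ
        High i = ∃ λ x → thr ≤ ⟦ M i ⟧ θ (x ∷ at a i)

        point : ∀ i → Dec (High i) → Carrier (M i)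
        point i (yes (x , _)) = x
        point i (no _)        = proj₁ (Inf-approx (M i) φ (at a i) 0<δ)

        x : Carrier Mꟳ
        x i = point i em

        K : Pred I ℓ
        K = proj₁ (eventually (Inf-isLimsup φ φ-lim a) 0<δ)
        K∈F : K ∈ sets F
        K∈F = proj₁ (proj₂ (eventually (Inf-isLimsup φ φ-lim a) 0<δ))
        inf≤ : ∀ i → i ∈ K → ⟦ M i ⟧ (Inf φ) (at a i) ≤ ⟦ Mꟳ ⟧ (Inf φ) a + fromℚ δ
        inf≤ = proj₂ (proj₂ (eventually (Inf-isLimsup φ φ-lim a) 0<δ))

        point-D : ∀ i → i ∈ K → (h : Dec (High i)) → thr ≤ D₁ (⟦ M i ⟧ φ (point i h ∷ at a i))
        point-D i i∈K (yes (x , thr≤)) = ≤-trans thr≤ (θ-≤D (M i) (x ∷ at a i))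
        point-D i i∈K (no _) = ≤-trans thr≤Δ (≤-trans (proj₂ fixed) (D↓ _ _ (≤-trans
          (≤-halves 2δ≤η (proj₂ (Inf-approx (M i) φ (at a i) 0<δ))
            (≤-trans (inf≤ i i∈K) (+-mono inf≤l ≤-refl))) thr≤Δ)))

        point-ψ : ∀ i → High i → (h : Dec (High i)) → thr ≤ ⟦ M i ⟧ ψ (point i h ∷ at a i)
        point-ψ i _    (yes (x , thr≤)) = ≤-trans thr≤ (θ-≤ψ (M i) (x ∷ at a i))
        point-ψ i high (no ¬high)       = ⊥-elim (¬high high)

        not-high : ∀ i → i ∈ K → ¬ High i → ⟦ M i ⟧ χ (at a i) ≤ thr
        not-high i i∈K ¬high = max-lub
          (≤-trans (inf≤ i i∈K) (+-mono inf≤l (half≤ 0<δ 2δ≤η)))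
          (Sup-≤ (M i) θ (at a i) λ x → ≤-total λ thr≤ → ¬high (x , thr≤))

        absurd : (∀ {J} → J ∈ sets F → ∃ λ i → i ∈ J × High i) → l < l
        absurd high-freq _ = <-+ l 0<η (≤-trans
          -- `D φ` is a limit inferior, so it needs the bound `thr` on a whole filter set, here `K`.
          -- For `ψ`, a limit superior, the indices in `High` are enough.
          (θ-glb Mꟳ (x ∷ a)
            (≤-approx λ 0<ε →
              let (i , i∈K , D≤) = nonincreasing-frequently F (continuous-∷ φ φ-lim x a) D D↓ 0<ε K∈F
              in ≤-trans (point-D i i∈K em) D≤)
            thr≤Δ
            (≤-limit F (continuous-∷ ψ ψ-lim x a) λ J∈F →
              let (i , i∈J , high) = high-freq J∈F in i , i∈J , point-ψ i high em))
          (≤-trans (≤-Sup Mꟳ θ a x) (max-≤ʳ _ _)))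

        χ-eventually : ∃ λ J → J ∈ sets F × (∀ i → i ∈ J → ⟦ M i ⟧ χ (at a i) ≤ thr)
        χ-eventually = by-contradiction λ none → absurd (λ {J} J∈F → by-contradiction λ never →
          none (J ∩ K , Filter.meet F J∈F K∈F , λ i (i∈J , i∈K) →
            not-high i i∈K λ high → never (i , i∈J , high))) ≤-refl

      -- When `Δ ≤ l` the supremum is harmless because `θ` never exceeds `Δ`. Otherwise there is
      -- room between `l` and `Δ` for the threshold of `Exceeding`.
      χ-eventually : Dec (Δ ≤ l) → ∀ {ε} → 0ℚ ℚ.< ε →
                     ∃ λ J → J ∈ sets F × (∀ i → i ∈ J → ⟦ M i ⟧ χ (at a i) ≤ l + fromℚ ε)
      χ-eventually (yes Δ≤l) 0<ε =
        let (J , J∈F , inf≤) = eventually (Inf-isLimsup φ φ-lim a) 0<ε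
        in J , J∈F , λ i i∈J → max-lub (≤-trans (inf≤ i i∈J) (+-mono inf≤l ≤-refl))
             (Sup-≤ (M i) θ (at a i) λ x → ≤-+ε 0<ε (≤-trans (θ-≤Δ (M i) (x ∷ at a i)) Δ≤l))
      χ-eventually (no Δ≰l) {ε} 0<ε =
        let (γ , 0<γ , l+γ≤Δ) = ∃-gap Δ≰l
            -- The minimum with the gap `γ` keeps the threshold at most `Δ`.
            (J , J∈F , χ≤) = Exceeding.χ-eventually {η = ε ℚ.⊓ γ} (⊓-glb-< 0<ε 0<γ)
              (≤-trans (+-mono ≤-refl (fromℚ-mono (ℚ.p⊓q≤q ε γ))) l+γ≤Δ)
        in J , J∈F , λ i i∈J → ≤-trans (χ≤ i i∈J) (+-mono ≤-refl (fromℚ-mono (ℚ.p⊓q≤p ε γ)))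

      -- If the supremum dominates, take a near maximizer `x` of `θ`: the lower bound on `D φ` at
      -- `x` holds eventually, the one on `ψ` frequently, so some index of `J` has both.
      χ-frequently : Dec (⟦ Mꟳ ⟧ (Sup θ) a ≤ ⟦ Mꟳ ⟧ (Inf φ) a) → ∀ {ε} → 0ℚ ℚ.< ε →
                     ∀ {J} → J ∈ sets F → ∃ λ i → i ∈ J × l ≤ ⟦ M i ⟧ χ (at a i) + fromℚ ε
      χ-frequently (yes sup≤inf) 0<ε J∈F =
        let (i , i∈J , inf≤) = frequently (Inf-isLimsup φ φ-lim a) 0<ε J∈F
        in i , i∈J , ≤-trans (max-lub ≤-refl sup≤inf) (≤-trans inf≤ (+-mono (max-≤ˡ _ _) ≤-refl))
      χ-frequently (no sup≰inf) 0<ε J∈F =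
        let (δ , 0<δ , 2δ≤ε) = halve 0<ε
            (x , ≤θx) = Sup-approx Mꟳ θ a 0<δ
            (K , K∈F , D≤) = nonincreasing-eventually F (continuous-∷ φ φ-lim x a) D D↓ 0<δ
            (i , (i∈J , i∈K) , ψ≤) =
              frequently (continuous-∷ ψ ψ-lim x a) 0<δ (Filter.meet F J∈F K∈F)
            ρ = x i ∷ at a i
            θx≤ = ≤-trans
              (min-glb (≤-trans (θ-≤D Mꟳ (x ∷ a)) (D≤ i i∈K))
                (min-glb (≤-+ε 0<δ (θ-≤Δ Mꟳ (x ∷ a))) (≤-trans (θ-≤ψ Mꟳ (x ∷ a)) ψ≤)))
              (≤-trans (min-+ (D₁ (⟦ M i ⟧ φ ρ)) (min-+′ Δ (⟦ M i ⟧ ψ ρ))) (+-mono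
                (θ-glb (M i) ρ (min-≤ˡ _ _) (≤-trans (min-≤ʳ _ _) (min-≤ˡ _ _))
                                            (≤-trans (min-≤ʳ _ _) (min-≤ʳ _ _))) ≤-refl))
        in i , i∈J , ≤-trans (max-lub (≤-total sup≰inf) ≤-refl) (≤-halves 2δ≤ε ≤θx
             (≤-trans θx≤ (+-mono (≤-trans (≤-Sup (M i) θ (at a i) (x i)) (max-≤ʳ _ _)) ≤-refl)))
        where
        min-+′ : ∀ x y {z} → min (x + z) (y + z) ≤ min x y + z
        min-+′ x y = min-shift ≤-refl ≤-refl
        min-+ : ∀ x {y y′ z} → y ≤ y′ + z → min (x + z) y ≤ min x y′ + z
        min-+ x y≤ = min-shift ≤-refl y≤

      χ-isLimsup : IsLimsup F (λ i → ⟦ M i ⟧ χ (at a i)) l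
      χ-isLimsup = record { eventually = χ-eventually em ; frequently = χ-frequently em }

    palyutin-continuous : ∀ {n} {φ : Formula L n} → Palyutin φ → Continuous φ
    palyutin-continuous (dist s t)            = dist-continuous s t
    palyutin-continuous (atom p ts)           = atom-continuous p ts
    palyutin-continuous (mono {φ = φ} C C↑ P) = mono-continuous {φ = φ} C C↑ (palyutin-continuous P)
    palyutin-continuous (maxP P Q)          a =
      max-isLimsup F (palyutin-continuous P a) (palyutin-continuous Q a)
    palyutin-continuous (Inf {φ = φ} P)     a = Inf-isLimsup φ (palyutin-continuous P) a
    palyutin-continuous (Sup {φ = φ} P)     a = Sup-isLimsup φ (palyutin-continuous P) a
    palyutin-continuous (max-inf-sup {φ = φ} {ψ} D Δ D↓ fixed P Q) a =
      MaxInfSup.χ-isLimsup φ ψ D Δ D↓ fixed (palyutin-continuous P) (palyutin-continuous Q) a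

-- Disjoint infinite subsets of the natural numbers.

module ProductAmalgamation (em : ∀ {ℓ} → ExcludedMiddle ℓ) (ext : ∀ {a b} → Extensionality a b) where

  open Classical em hiding (δ)
  open ℝ-Lemmas
  open RealArithmetic em
  open FormulaLemmas em ext
  open PalyutinProducts em ext
  open Structure using (Carrier)

  module _ {ℓ} {n} {S : Fin (suc n) → ℕ → Set ℓ} (S-infinite : ∀ j N → ∃ λ i → N ℕ.≤ i × S j i) where

    private
      target : ℕ → Fin (suc n)
      target m = m mod suc n

      target-hits : ∀ j N → target (toℕ j ℕ.+ N ℕ.* suc n) ≡ j
      target-hits j N = toℕ-injective (trans (toℕ-fromℕ< _)
        (trans ([m+kn]%n≡m%n (toℕ j) N (suc n)) (m<n⇒m%n≡m (toℕ<n j))))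

      -- A strictly increasing sequence that visits the sets `S j` cyclically. Being injective, it
      -- lets the visited number determine which set it was chosen from.
      t : ℕ → ℕ
      t zero    = proj₁ (S-infinite (target zero) zero)
      t (suc m) = proj₁ (S-infinite (target (suc m)) (suc (t m)))

      t∈S : ∀ m → S (target m) (t m)
      t∈S zero    = proj₂ (proj₂ (S-infinite (target zero) zero))
      t∈S (suc m) = proj₂ (proj₂ (S-infinite (target (suc m)) (suc (t m))))

      t-step : ∀ m → t m ℕ.< t (suc m)
      t-step m = proj₁ (proj₂ (S-infinite (target (suc m)) (suc (t m))))

      t-mono : ∀ k m → t m ℕ.< t (suc k ℕ.+ m)
      t-mono zero    m = t-step m
      t-mono (suc k) m = ℕ.<-trans (t-mono k m) (t-step (suc k ℕ.+ m))

      t-mono-< : ∀ {m m′} → m ℕ.< m′ → t m ℕ.< t m′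
      t-mono-< {m} {m′} m<m′ = subst (λ z → t m ℕ.< t z)
        (trans (sym (ℕ.+-suc (m′ ℕ.∸ suc m) m)) (ℕ.m∸n+n≡m m<m′)) (t-mono (m′ ℕ.∸ suc m) m)

      t-injective : ∀ {m m′} → t m ≡ t m′ → m ≡ m′
      t-injective {m} {m′} eq with ℕ.<-cmp m m′
      ... | tri< m<m′ _ _ = ⊥-elim (ℕ.<-irrefl eq (t-mono-< m<m′))
      ... | tri≈ _ m≡m′ _ = m≡m′
      ... | tri> _ _ m′<m = ⊥-elim (ℕ.<-irrefl (sym eq) (t-mono-< m′<m))

      m≤tm : ∀ m → m ℕ.≤ t m
      m≤tm zero    = ℕ.z≤n
      m≤tm (suc m) = ℕ.≤-<-trans (m≤tm m) (t-step m)

      colour : ∀ i → Dec (∃ λ m → t m ≡ i) → Fin (suc n)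
      colour i (yes (m , _)) = target m
      -- Numbers that are never visited get an arbitrary colour.
      colour i (no _)        = zero

      colour-t : ∀ m (h : Dec (∃ λ m′ → t m′ ≡ t m)) → colour (t m) h ≡ target m
      colour-t m (yes (m′ , eq)) = cong target (t-injective {m′} {m} eq)
      colour-t m (no ∄)          = ⊥-elim (∄ (m , refl))

    -- Infinite sets S j contain disjoint infinite subsets, the fibres of c.
    opaque
      disjoint-refinement : ∃ λ (c : ℕ → Fin (suc n)) → ∀ j N → ∃ λ i → N ℕ.≤ i × S j i × c i ≡ j
      disjoint-refinement = (λ i → colour i em) , λ j N →
        -- This `m` is congruent to `j` and at least `N`, and `t m` is at least `m`.
        let m = toℕ j ℕ.+ N ℕ.* suc n
            N≤m = ℕ.≤-trans (ℕ.m≤m*n N (suc n)) (ℕ.m≤n+m (N ℕ.* suc n) (toℕ j))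
        in t m , ℕ.≤-trans N≤m (m≤tm m) , subst (λ k → S k (t m)) (target-hits j N) (t∈S m) ,
           trans (colour-t m em) (target-hits j N)

  -- SCP in reduced products, by gluing points of the factors.

  module _ {ℓ} {L : Signature ℓ} {I : Set ℓ} (M : I → Structure L) (F : Filter I) where

    private
      Mꟳ′ : Structure L
      Mꟳ′ = Mꟳ M F

    module _ {k m} (a : Vector (Carrier Mꟳ′) k) (b : Vector (Carrier Mꟳ′) m) where

      prepend-isLimsup : ∀ {φ : Formula L (k ℕ.+ m)} → Palyutin φ → IsLimsup F
        (λ i → ⟦ M i ⟧ φ (prepend (at M F a i) (at M F b i))) (⟦ Mꟳ′ ⟧ φ (prepend a b))
      prepend-isLimsup {φ} Pφ = subst (λ u → IsLimsup F u (⟦ Mꟳ′ ⟧ φ (prepend a b)))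
        (ext λ i → cong (⟦ M i ⟧ φ) (at-prepend M F a b i))
        (palyutin-continuous M F Pφ (prepend a b))

      module _ {ψ : Formula L (k ℕ.+ m)} (Pψ : Palyutin ψ) (D : Connective 1) (D↓ : Nonincreasing D) where

        -- The value of `D $ ψ` is a limit inferior, so its smallness descends to frequently many
        -- factors; `≤-if-frequently` is the way back.
        frequently-≤ : ∀ {c ε} → ⟦ Mꟳ′ ⟧ (D $ ψ) (prepend a b) ≤ c → 0ℚ ℚ.< ε → ∀ {J} → J ∈ sets F →
          ∃ λ i → i ∈ J × ⟦ M i ⟧ (D $ ψ) (prepend (at M F a i) (at M F b i)) ≤ c + fromℚ ε
        frequently-≤ Dψ≤c 0<ε J∈F =
          let (i , i∈J , D≤) = nonincreasing-frequently F (prepend-isLimsup Pψ) D D↓ 0<ε J∈F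
          in i , i∈J , ≤-trans (≤-reflexive ($-value (M i) D ψ _)) (≤-trans D≤
               (+-mono (≤-trans (≤-reflexive (sym ($-value Mꟳ′ D ψ _))) Dψ≤c) ≤-refl))

        ≤-if-frequently : ∀ {c} → (∀ {J} → J ∈ sets F →
          ∃ λ i → i ∈ J × ⟦ M i ⟧ (D $ ψ) (prepend (at M F a i) (at M F b i)) ≤ c) →
          ⟦ Mꟳ′ ⟧ (D $ ψ) (prepend a b) ≤ c
        ≤-if-frequently h = ≤-approx λ 0<ε →
          let (J , J∈F , D≤) = nonincreasing-eventually F (prepend-isLimsup Pψ) D D↓ 0<ε
              (i , i∈J , Dψ≤c) = h J∈F
          in ≤-trans (≤-reflexive ($-value Mꟳ′ D ψ _)) (≤-trans (D≤ i i∈J)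
               (+-mono (≤-trans (≤-reflexive (sym ($-value (M i) D ψ _))) Dψ≤c) ≤-refl))

    module Amalgam {n} k m {φ : Formula L (k ℕ.+ m)} {ψ : Vector (Formula L (k ℕ.+ m)) (suc (suc n))}
      (D : Vector (Connective 1) (suc (suc n)))
      (Pφ : Palyutin φ) (Pψ : ∀ j → Palyutin (ψ j)) (D↓ : ∀ j → Nonincreasing (D j))
      (b : Vector (Carrier Mꟳ′) m) {c : ℝ} {ε : ℚ} (0<ε : 0ℚ ℚ.< ε)
      (h : ∀ j → ∃ λ a → ⟦ Mꟳ′ ⟧ φ (prepend a b) ≤ c × ⟦ Mꟳ′ ⟧ (D j $ ψ j) (prepend a b) ≤ c) where

      point : ∀ j i → Vector (Carrier (M i)) k
      point j = at M F (proj₁ (h j))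

      Small : ∀ i → Fin (suc (suc n)) → Vector (Carrier (M i)) k → Set
      Small i j x = ⟦ M i ⟧ (D j $ ψ j) (prepend x (at M F b i)) ≤ c + fromℚ ε

      small-frequently : ∀ j {J} → J ∈ sets F → ∃ λ i → i ∈ J × Small i j (point j i)
      small-frequently j =
        frequently-≤ (proj₁ (h j)) b (Pψ j) (D j) (D↓ j) (proj₂ (proj₂ (h j))) 0<ε

      φ-small : ∃ λ K → K ∈ sets F × (∀ i → i ∈ K → ∀ j →
        ⟦ M i ⟧ φ (prepend (point j i) (at M F b i)) ≤ c + fromℚ ε)
      φ-small =
        let (K , K∈F , K⊆) = Limsup-Lemmas.meets F (λ j → proj₁ (near j)) (λ j → proj₁ (proj₂ (near j)))
        in K , K∈F , λ i i∈K j → ≤-trans (proj₂ (proj₂ (near j)) i (K⊆ j i∈K))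
             (+-mono (proj₁ (proj₂ (h j))) ≤-refl)
        where
        near : ∀ j → ∃ λ J → J ∈ sets F × (∀ i → i ∈ J → ⟦ M i ⟧ φ (prepend (point j i) (at M F b i)) ≤
               ⟦ Mꟳ′ ⟧ φ (prepend (proj₁ (h j)) b) + fromℚ ε)
        near j = eventually (prepend-isLimsup (proj₁ (h j)) b Pφ) 0<ε

      -- `φ` has to be small on one filter set, but each `D j $ ψ j` only frequently, and different
      -- `j` may use different indices. This freedom is what makes amalgamation possible.
      glue : ∀ {c′ K} → K ∈ sets F → (x : ∀ i → Vector (Carrier (M i)) k) →
        (∀ i → i ∈ K → ⟦ M i ⟧ φ (prepend (x i) (at M F b i)) ≤ c′) →
        (∀ j {J} → J ∈ sets F →
          ∃ λ i → i ∈ J × ⟦ M i ⟧ (D j $ ψ j) (prepend (x i) (at M F b i)) ≤ c′) →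
        ∃ λ a → ⟦ Mꟳ′ ⟧ φ (prepend a b) ≤ c′ × (∀ j → ⟦ Mꟳ′ ⟧ (D j $ ψ j) (prepend a b) ≤ c′)
      glue K∈F x φ≤ Dψ≤ =
        let a = λ l i → x i l
        in a , limit-≤ F (prepend-isLimsup a b Pφ) K∈F φ≤ ,
           λ j → ≤-if-frequently a b (Pψ j) (D j) (D↓ j) (Dψ≤ j)

    -- In each factor SCP is applied to those `j` whose own point is small there. As this happens
    -- frequently for each `j`, the resulting points can be glued.
    amalgamates-product : (λ i → M i ⊨ SCP L) ∈ sets F → Amalgamates Mꟳ′
    amalgamates-product M⊨SCP {n} k m {φ} {ψ} D Pφ Pψ D↓ b {c} {ε} 0<ε h =
      glue {c + fromℚ ε} {K} (Filter.meet F (proj₁ (proj₂ φ-small)) M⊨SCP) (λ i → x i em)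
        (λ i i∈K → x-φ i em i∈K)
        (λ j J∈F →
          let (i , (i∈J , i∈K) , small) = small-frequently j
                (Filter.meet F J∈F (Filter.meet F (proj₁ (proj₂ φ-small)) M⊨SCP))
          in i , i∈J , x-ψ i em i∈K j small)
      where
      halves : ∃ λ δ → 0ℚ ℚ.< δ × fromℚ δ + fromℚ δ ≤ fromℚ ε
      halves = halve 0<ε
      δ : ℚ
      δ = proj₁ halves
      2δ≤ε : fromℚ δ + fromℚ δ ≤ fromℚ ε
      2δ≤ε = proj₂ (proj₂ halves)
      -- One `δ` is spent on descending to the factors and another on SCP inside a factor, whence
      -- `c″`.
      open Amalgam k m D Pφ Pψ D↓ b (proj₁ (proj₂ halves)) h

      c″ : ℝ
      c″ = (c + fromℚ δ) + fromℚ δ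

      K : Pred I ℓ
      K = proj₁ φ-small ∩ (λ i → M i ⊨ SCP L)

      Solution : ∀ i → Vector (Carrier (M i)) k → Set
      Solution i x = ⟦ M i ⟧ φ (prepend x (at M F b i)) ≤ c″ ×
        (∀ j → Small i j (point j i) → ⟦ M i ⟧ (D j $ ψ j) (prepend x (at M F b i)) ≤ c″)

      module _ (i : I) (i∈K : i ∈ K) where

        -- SCP is applied to a family of the original length, so an index that is not small in this
        -- factor is replaced by a copy of the small index `j₀`.
        redirect : Fin (suc (suc n)) → ∀ j → Dec (Small i j (point j i)) → Fin (suc (suc n))
        redirect j₀ j (yes _) = j
        redirect j₀ j (no _)  = j₀

        redirect-small : ∀ {j₀} → Small i j₀ (point j₀ i) → ∀ j d →
                         let j′ = redirect j₀ j d in Small i j′ (point j′ i)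
        redirect-small s₀ j (yes s) = s
        redirect-small s₀ j (no _)  = s₀

        redirect-≡ : ∀ j₀ j d → Small i j (point j i) → redirect j₀ j d ≡ j
        redirect-≡ j₀ j (yes _) s = refl
        redirect-≡ j₀ j (no ¬s) s = ⊥-elim (¬s s)

        solve : Dec (∃ λ j → Small i j (point j i)) → ∃ (Solution i)
        -- With no small `j` only `φ` is to be controlled, and any of the given points does that.
        solve (no none) = point zero i , ≤-+ε (proj₁ (proj₂ halves)) (proj₂ (proj₂ φ-small) i (proj₁ i∈K) zero) ,
          λ j s → ⊥-elim (none (j , s))
        solve (yes (j₀ , s₀)) =
          let g = λ j → redirect j₀ j em
              (x , φ≤ , Dψ≤) = ⊨SCP⇒amalgamates (proj₂ i∈K) k m (D ∘ g) Pφ (Pψ ∘ g) (D↓ ∘ g) (at M F b i)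
                (proj₁ (proj₂ halves)) λ j →
                  point (g j) i , proj₂ (proj₂ φ-small) i (proj₁ i∈K) (g j) , redirect-small s₀ j em
          in x , φ≤ , λ j s → subst (λ j → ⟦ M i ⟧ (D j $ ψ j) (prepend x (at M F b i)) ≤ c″)
               (redirect-≡ j₀ j em s) (Dψ≤ j)

      x : ∀ i → Dec (i ∈ K) → Vector (Carrier (M i)) k
      x i (yes i∈K) = proj₁ (solve i i∈K em)
      x i (no _)    = point zero i

      c″≤ : c″ ≤ c + fromℚ ε
      c″≤ = ≤-halves 2δ≤ε ≤-refl ≤-refl

      x-φ : ∀ i d → i ∈ K → ⟦ M i ⟧ φ (prepend (x i d) (at M F b i)) ≤ c + fromℚ ε
      x-φ i (yes i∈K) _   = ≤-trans (proj₁ (proj₂ (solve i i∈K em))) c″≤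
      x-φ i (no i∉K)  i∈K = ⊥-elim (i∉K i∈K)

      x-ψ : ∀ i d → i ∈ K → ∀ j → Small i j (point j i) →
            ⟦ M i ⟧ (D j $ ψ j) (prepend (x i d) (at M F b i)) ≤ c + fromℚ ε
      x-ψ i (yes i∈K) _   j s = ≤-trans (proj₂ (proj₂ (solve i i∈K em)) j s) c″≤
      x-ψ i (no i∉K)  i∈K j s = ⊥-elim (i∉K i∈K)

  module _ {ℓ} {L : Signature ℓ} (M : Lift ℓ ℕ → Structure L) (F : Filter (Lift ℓ ℕ))
    (tail∈F : ∀ N → (λ i → Lift ℓ (N ℕ.≤ Lift.lower i)) ∈ sets F)
    (F-cofinite : ∀ {J} → J ∈ sets F → ∃ λ N → ∀ i → N ℕ.≤ i → lift i ∈ J) where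

    -- The glued point follows `point j` on the infinite set of colour `j`, which meets every
    -- cofinite set, so each `D j $ ψ j` is small frequently. `φ` is small at all the points
    -- `point j` on the filter set `K`.
    amalgamates-cofinite : Amalgamates (Mꟳ M F)
    amalgamates-cofinite {n} k m {φ} {ψ} D Pφ Pψ D↓ b {c} {ε} 0<ε h =
      glue {c + fromℚ ε} {K} (proj₁ (proj₂ φ-small)) x x-φ x-ψ
      where
      open Amalgam M F k m {φ} {ψ} D Pφ Pψ D↓ b 0<ε h

      K : Pred (Lift ℓ ℕ) ℓ
      K = proj₁ φ-small

      SmallAt : Fin (suc (suc n)) → ℕ → Set
      SmallAt j i = Small (lift i) j (point j (lift i))

      small-infinite : ∀ j N → ∃ λ i → N ℕ.≤ i × SmallAt j i
      small-infinite j N =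
        let (i , N≤i , s) = small-frequently j (tail∈F N)
        in Lift.lower i , Lift.lower N≤i , s

      c′ : ℕ → Fin (suc (suc n))
      c′ = proj₁ (disjoint-refinement {S = SmallAt} small-infinite)

      x : ∀ i → Vector (Carrier (M i)) k
      x i = point (c′ (Lift.lower i)) i

      x-φ : ∀ i → i ∈ K → ⟦ M i ⟧ φ (prepend (x i) (at M F b i)) ≤ c + fromℚ ε
      x-φ i i∈K = proj₂ (proj₂ φ-small) i i∈K (c′ (Lift.lower i))

      x-ψ : ∀ j {J} → J ∈ sets F → ∃ λ i → i ∈ J × Small i j (x i)
      x-ψ j J∈F =
        let (N , ⊆J) = F-cofinite J∈F
            (i , N≤i , s , c′i≡j) = proj₂ (disjoint-refinement {S = SmallAt} small-infinite) j N
        in lift i , ⊆J i N≤i , subst (λ j′ → Small (lift i) j (point j′ (lift i))) (sym c′i≡j) s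

-- Control of arbitrary formulas by Palyutin formulas.

module Determination (em : ∀ {ℓ} → ExcludedMiddle ℓ) (ext : ∀ {a b} → Extensionality a b) where

  open Classical em hiding (δ)
  open ℝ-Lemmas
  open RealArithmetic em
  open Compactness em
  open FormulaLemmas em ext
  open Structure using (Carrier)

  translateᶜ : ℝ → Connective 1
  translateᶜ r = record
    { apply      = λ v → v zero + r
    ; continuous = λ _ ε 0<ε → ε , 0<ε , λ _ h → shift (proj₁ (h zero)) , shift (proj₂ (h zero))
    }
    where
    shift : ∀ {x y ε} → x ≤ y + ε → x + r ≤ (y + r) + ε
    shift h = ≤-trans (+-mono h ≤-refl) (≤-trans (+-assoc _ _ _)
      (≤-trans (+-mono ≤-refl (+-comm _ _)) (+-assoc⁻ _ _ _)))

  translateᶜ-nondecreasing : ∀ r → Nondecreasing (translateᶜ r)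
  translateᶜ-nondecreasing r x y x≤y = +-mono x≤y ≤-refl

  negateᶜ : Connective 1
  negateᶜ = record
    { apply      = λ v → - v zero
    ; continuous = λ _ ε 0<ε →
        let (q , 0<q , q≤ε) = ∃-rational-below 0<ε
        in fromℚ q , fromℚ-pos 0<q , λ _ h →
          ≤-trans (neg-shift (proj₂ (h zero))) (+-mono ≤-refl q≤ε) ,
          ≤-trans (neg-shift (proj₁ (h zero))) (+-mono ≤-refl q≤ε)
    }

  negateᶜ-nonincreasing : Nonincreasing negateᶜ
  negateᶜ-nonincreasing x y = neg-antitone

  neg-≤ : ∀ {x z} → 0ᵣ ≤ z + x → - x ≤ z
  neg-≤ h = ≤-trans (≤-trans (≤+ _ ≤-refl) (+-comm _ _)) (≤-+⇒-≤ h)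

  neg-≤⁻ : ∀ {x z} → - x ≤ z → 0ᵣ ≤ z + x
  neg-≤⁻ h = -≤⇒≤-+ (≤-trans (+-identityˡ-≤ _) h)

  -0≈0 : (- 0ᵣ) ≈ 0ᵣ
  -0≈0 = neg-≤ (≤+ _ ≤-refl) , ≤-trans (neg-≤⁻ ≤-refl) (+-identityʳ-≤ _)

  opaque
    ·-homo-+ : ∀ a b p → a · p ℚ.+ b · p ≡ (a ℕ.+ b) · p
    ·-homo-+ zero    b p = ℚ.+-identityˡ _
    ·-homo-+ (suc a) b p = trans (ℚ.+-assoc p (a · p) (b · p)) (cong (p ℚ.+_) (·-homo-+ a b p))

  opaque
    ·-pos : ∀ k {p} → 0ℚ ℚ.< p → 0ℚ ℚ.< suc k · p
    ·-pos k {p} 0<p = ℚ.+-mono-<-≤ {0ℚ} {p} {0ℚ} {k · p} 0<p (·-nonneg k (ℚ.<⇒≤ 0<p))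

  opaque
    -- The errors made in `Extension` stay within `16` multiples of `η`.
    sixteenth : ∀ {ε} → 0ℚ ℚ.< ε → ∃ λ η → 0ℚ ℚ.< η × 16 · η ≡ ε
    sixteenth {ε} 0<ε = ½^ 4 ℚ.* ε , subst (ℚ._< ½^ 4 ℚ.* ε) (ℚ.*-zeroʳ (½^ 4)) (ℚ.*-monoʳ-<-pos (½^ 4) 0<ε) ,
      trans (sym (·-* 16 (½^ 4) ε)) (ℚ.*-identityˡ ε)

  -- Errors are counted in multiples of `η`, so that combining estimates becomes addition of
  -- numerals, done by computation.
  module Multiples {η} (0<η : 0ℚ ℚ.< η) where

    e : ℝ
    e = fromℚ η

    opaque
      [_] : ℕ → ℝ
      [ k ] = fromℚ (k · η)

      fromℚ-·-≈ : ∀ k → fromℚ (k · η) ≈ [ k ]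
      fromℚ-·-≈ k = ≤-refl , ≤-refl

      []-+ : ∀ a b → [ a ] + [ b ] ≤ [ a ℕ.+ b ]
      []-+ a b = ≤-trans (fromℚ-+ _ _) (≤-reflexive (cong fromℚ (·-homo-+ a b η)))

      e≤[1] : e ≤ [ 1 ]
      e≤[1] = ≤-reflexive (cong fromℚ (sym (ℚ.+-identityʳ η)))

      []-mono : ∀ a b → [ a ] ≤ [ b ℕ.+ a ]
      []-mono a zero    = ≤-refl
      []-mono a (suc b) = ≤-trans ([]-mono a b) (fromℚ-mono (subst (ℚ._≤ η ℚ.+ (b ℕ.+ a) · η)
        (ℚ.+-identityˡ ((b ℕ.+ a) · η)) (ℚ.+-monoˡ-≤ ((b ℕ.+ a) · η) (ℚ.<⇒≤ 0<η))))

      0≤[] : ∀ k → 0ᵣ ≤ [ k ]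
      0≤[] k = fromℚ-mono (·-nonneg k (ℚ.<⇒≤ 0<η))

    +-[] : ∀ a b {x y} → x ≤ y + [ a ] → x + [ b ] ≤ y + [ a ℕ.+ b ]
    +-[] a b h = ≤-trans (+-mono h ≤-refl) (≤-trans (+-assoc _ _ _) (+-mono ≤-refl ([]-+ a b)))

    trans-[] : ∀ a b {x y z} → x ≤ y + [ a ] → y ≤ z + [ b ] → x ≤ z + [ b ℕ.+ a ]
    trans-[] a b x≤y y≤z = ≤-trans x≤y (+-[] b a y≤z)

    <-[] : ∀ x a → x < x + [ a ℕ.+ 1 ]
    <-[] x a = <-≤-trans (<-+ x 0<η) (+-mono ≤-refl (≤-trans e≤[1] ([]-mono 1 a)))

  module _ {ℓ} {L : Signature ℓ} where

    PalyutinFormula : ℕ → Set ℓ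
    PalyutinFormula n = Σ (Formula L n) Palyutin

    -- Let x in M make φ ≤ -4η and all ψ j ≥ 0, and let Inf φ and the χ j agree in M and
    -- N up to η.  Then Inf φ ≤ -3η and χ j ≥ -η in N, so the supremum in χ j yields a
    -- point with φ ≤ 2η and ψ j ≥ -2η for each j, and SCP merges these points.
    module Transfer {n k} {φ : Formula L (suc n)} {ψ : Vector (Formula L (suc n)) (suc (suc k))}
                    (Pφ : Palyutin φ) (Pψ : ∀ j → Palyutin (ψ j)) where

      θ : Fin (suc (suc k)) → Formula L (suc n)
      θ j = conn minᶜ ((negateᶜ $ φ) ∷ conn (constᶜ 0ᵣ) [] ∷ ψ j ∷ [])

      χ : Fin (suc (suc k)) → Formula L n
      χ j = max₂ (Inf φ) (Sup (θ j))

      χ-palyutin : ∀ j → Palyutin (χ j)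
      χ-palyutin j = max-inf-sup negateᶜ 0ᵣ negateᶜ-nonincreasing -0≈0 Pφ (Pψ j)

      module _ {M N : Structure L} (N⊨SCP : N ⊨ SCP L) (a : Vector (Carrier M) n) (b : Vector (Carrier N) n)
               {η} (0<η : 0ℚ ℚ.< η) where

        open Multiples 0<η

        module _ (inf-close : Within e (⟦ M ⟧ (Inf φ) a) (⟦ N ⟧ (Inf φ) b))
                 (χ-close : ∀ j → Within e (⟦ M ⟧ (χ j) a) (⟦ N ⟧ (χ j) b))
                 (x : Carrier M) (φx≤ : ⟦ M ⟧ φ (x ∷ a) + [ 4 ] ≤ 0ᵣ) (0≤ψx : ∀ j → 0ᵣ ≤ ⟦ M ⟧ (ψ j) (x ∷ a)) where

          private
            φx : ℝ
            φx = ⟦ M ⟧ φ (x ∷ a)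

          inf-negative : ¬ (0ᵣ ≤ ⟦ N ⟧ (Inf φ) b + e)
          inf-negative 0≤inf = <-[] (φx + [ 2 ]) 1 (begin
            (φx + [ 2 ]) + [ 2 ]         ≤⟨ +-[] 2 2 {φx + [ 2 ]} ≤-refl ⟩
            φx + [ 4 ]                   ≤⟨ φx≤ ⟩
            0ᵣ                           ≤⟨ 0≤inf ⟩
            ⟦ N ⟧ (Inf φ) b + e          ≤⟨ +-mono (proj₂ inf-close) ≤-refl ⟩
            (⟦ M ⟧ (Inf φ) a + e) + e    ≤⟨ +-mono (+-mono (Inf-≤ M φ a x) e≤[1]) e≤[1] ⟩
            (φx + [ 1 ]) + [ 1 ]         ≤⟨ +-[] 1 1 {φx + [ 1 ]} ≤-refl ⟩
            φx + [ 2 ]                   ∎)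
            where open PartialOrderReasoning ≤-poset

          0≤χ : ∀ j → 0ᵣ ≤ ⟦ N ⟧ (χ j) b + e
          0≤χ j = ≤-trans (min-glb 0≤-φx (min-glb ≤-refl (0≤ψx j)))
            (≤-trans (≤-Sup M (θ j) a x) (≤-trans (max-≤ʳ _ _) (proj₁ (χ-close j))))
            where
            0≤-φx : 0ᵣ ≤ - φx
            0≤-φx = ≤-trans (+-≤⇒≤- (≤-trans (+-comm _ _)
              (≤-trans (+-mono ≤-refl (0≤[] 4)) φx≤))) (+-identityˡ-≤ _)

          -- `χ j` is a maximum that is at least `-η` up to closeness, while its branch `Inf φ` is
          -- below `-η`; hence the supremum carries the bound.
          0≤sup : ∀ j → Dec (⟦ N ⟧ (Inf φ) b ≤ ⟦ N ⟧ (Sup (θ j)) b) → 0ᵣ ≤ ⟦ N ⟧ (Sup (θ j)) b + e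
          0≤sup j (yes inf≤sup) = ≤-trans (0≤χ j) (+-mono (max-lub inf≤sup ≤-refl) ≤-refl)
          0≤sup j (no inf≰sup)  = ⊥-elim (inf-negative
            (≤-trans (0≤χ j) (+-mono (max-lub ≤-refl (≤-total inf≰sup)) ≤-refl)))

          near : ∀ j → ∃ λ y → ⟦ N ⟧ φ (y ∷ b) ≤ [ 2 ] × (- ⟦ N ⟧ (ψ j) (y ∷ b)) ≤ [ 2 ]
          near j =
            let (y , sup≤) = Sup-approx N (θ j) b 0<η
                0≤θ : 0ᵣ ≤ [ 2 ] + ⟦ N ⟧ (θ j) (y ∷ b)
                0≤θ = ≤-trans (trans-[] 1 1 (≤-trans (0≤sup j em) (+-mono ≤-refl e≤[1]))
                                            (≤-trans sup≤ (+-mono ≤-refl e≤[1]))) (+-comm _ _)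
            in y ,
               ≤-trans (≤-trans (≤+ _ ≤-refl) (+-comm _ _))
                 (≤-⇒+-≤ (≤-trans 0≤θ (+-mono ≤-refl (min-≤ˡ _ _)))) ,
               neg-≤ (≤-trans 0≤θ (+-mono ≤-refl (≤-trans (min-≤ʳ _ _) (min-≤ʳ _ _))))

          opaque
            transfer : ∃ λ y → ⟦ N ⟧ φ (y ∷ b) ≤ [ 3 ] × (∀ j → 0ᵣ ≤ [ 3 ] + ⟦ N ⟧ (ψ j) (y ∷ b))
            transfer =
              -- The tuple to be amalgamated is the single bound variable, and amalgamation raises
              -- the error from `2` to `3`.
              let (y , φ≤ , -ψ≤) = ⊨SCP⇒amalgamates N⊨SCP 1 n {φ} {ψ} (λ _ → negateᶜ) Pφ Pψ
                    (λ _ → negateᶜ-nonincreasing) b 0<η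
                    λ j → let (y , φ≤ , -ψ≤) = near j in (λ _ → y) , φ≤ , -ψ≤
              in head y , ≤-trans φ≤ 2+1≤3 , λ j → neg-≤⁻ (≤-trans (-ψ≤ j) 2+1≤3)
              where
              2+1≤3 : [ 2 ] + e ≤ [ 3 ]
              2+1≤3 = ≤-trans (+-mono ≤-refl e≤[1]) ([]-+ 2 1)

    -- A basic neighbourhood for types restricted to Palyutin formulas: finitely many formulas with
    -- a common tolerance.
    record Test (n : ℕ) : Set ℓ where
      field
        formulas  : List (PalyutinFormula n)
        tolerance : ℚ
        positive  : 0ℚ ℚ.< tolerance

    open Test

    Close : ∀ {n} → Test n → (M N : Structure L) → Vector (Carrier M) n → Vector (Carrier N) n → Set ℓ
    Close t M N a b = ∀ {φ} → φ ∈ˡ formulas t →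
      Within (fromℚ (tolerance t)) (⟦ M ⟧ (proj₁ φ) a) (⟦ N ⟧ (proj₁ φ) b)

    Close-sym : ∀ {n} (t : Test n) {M N a b} → Close t M N a b → Close t N M b a
    Close-sym t close φ∈ = Within-sym (close φ∈)

    -- Uniform continuity of `θ` in the Palyutin formulas: the test depends on `ε` but not on models
    -- or tuples. One inequality suffices because `Close` is symmetric.
    Determined : ∀ {n} → Formula L n → Set (lsuc ℓ)
    Determined {n} θ = ∀ {ε} → 0ℚ ℚ.< ε → ∃ λ (t : Test n) → ∀ {M N} → M ⊨ SCP L → N ⊨ SCP L →
      ∀ a b → Close t M N a b → ⟦ M ⟧ θ a ≤ ⟦ N ⟧ θ b + fromℚ ε

    opaque
      palyutin-determined : ∀ {n} {φ : Formula L n} → Palyutin φ → Determined φ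
      palyutin-determined {φ = φ} Pφ {ε} 0<ε =
        record { formulas = (φ , Pφ) ∷ˡ []ˡ ; tolerance = ε ; positive = 0<ε } ,
        λ _ _ _ _ close → proj₁ (close (here refl))

    opaque
      combine : ∀ {k n} (t : Fin k → Test n) → ∃ λ t′ →
                ∀ {M N a b} → Close t′ M N a b → ∀ j → Close (t j) M N a b
      combine {zero}  t = record { formulas = []ˡ ; tolerance = 1ℚ ; positive = ℚ.positive⁻¹ 1ℚ } , λ _ ()
      combine {suc k} t =
        let (t′ , close′) = combine (t ∘ suc)
            p = tolerance (t zero)
            q = tolerance t′
        in record { formulas  = formulas (t zero) List.++ formulas t′
                  ; tolerance = p ℚ.⊓ q
                  ; positive  = ⊓-glb-< (positive (t zero)) (positive t′)
                  } , λ close → λ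
           { zero    → λ φ∈ → Within-weaken (fromℚ-mono (ℚ.p⊓q≤p p q)) (close (∈-++⁺ˡ φ∈))
           ; (suc j) → close′ (λ φ∈ → Within-weaken (fromℚ-mono (ℚ.p⊓q≤q p q))
                                         (close (∈-++⁺ʳ (formulas (t zero)) φ∈))) j }

    opaque
      -- On the box given by `bounds` the connective is uniformly continuous, so it is enough to
      -- control each argument in both directions by one combined test.
      conn-determined : ∀ {n m} (C : Connective m) (θs : Vector (Formula L n) m) →
                        (∀ j → Determined (θs j)) → Determined (conn C θs)
      conn-determined C θs det 0<ε =
        let lo = λ j → proj₁ (bounds (θs j))
            hi = λ j → proj₁ (proj₂ (bounds (θs j)))
            (η , 0<η , near) = uniformly-continuous C lo hi 0<ε
            (t , close) = combine λ j → proj₁ (det j 0<η)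
        in t , λ {M} {N} M⊨ N⊨ a b t-close → near _ _
             (λ j → proj₂ (proj₂ (bounds (θs j))) N b)
             λ j → proj₂ (det j 0<η) M⊨ N⊨ a b (close t-close j) ,
                   proj₂ (det j 0<η) N⊨ M⊨ b a (Close-sym (proj₁ (det j 0<η)) (close t-close j))

    -- Iterated `max₂` in place of a single `maxᶜ`, since `Palyutin` is closed under binary maxima
    -- by definition.
    maxₚ : ∀ {k n} → Vector (PalyutinFormula n) (suc k) → PalyutinFormula n
    maxₚ {zero}  φs = head φs
    maxₚ {suc k} φs =
      max₂ (proj₁ (head φs)) (proj₁ (maxₚ (tail φs))) , maxP (proj₂ (head φs)) (proj₂ (maxₚ (tail φs)))

    module _ (M : Structure L) {n} (ρ : Vector (Carrier M) n) where

      ≤-maxₚ : ∀ {k} (φs : Vector (PalyutinFormula n) (suc k)) j →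
               ⟦ M ⟧ (proj₁ (φs j)) ρ ≤ ⟦ M ⟧ (proj₁ (maxₚ φs)) ρ
      ≤-maxₚ {zero}  φs zero    = ≤-refl
      ≤-maxₚ {suc k} φs zero    = max-≤ˡ _ _
      ≤-maxₚ {suc k} φs (suc j) = ≤-trans (≤-maxₚ (tail φs) j) (max-≤ʳ _ _)

      maxₚ-≤ : ∀ {k} (φs : Vector (PalyutinFormula n) (suc k)) {c} →
               (∀ j → ⟦ M ⟧ (proj₁ (φs j)) ρ ≤ c) → ⟦ M ⟧ (proj₁ (maxₚ φs)) ρ ≤ c
      maxₚ-≤ {zero}  φs h = h zero
      maxₚ-≤ {suc k} φs h = max-lub (h zero) (maxₚ-≤ (tail φs) (h ∘ suc))

    -- Rounding the values v of p at x to a grid point g within 4η makes uppers g at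
    -- most -4η and lowers g at least 0 at x, and the point y of N given by Transfer has
    -- values w of p within 15η of v.
    module Extension {n} (t : Test (suc n)) where

      η : ℚ
      η = proj₁ (sixteenth (positive t))
      0<η : 0ℚ ℚ.< η
      0<η = proj₁ (proj₂ (sixteenth (positive t)))

      open Multiples 0<η

      [16]≤ : [ 16 ] ≤ fromℚ (tolerance t)
      [16]≤ = ≤-trans (proj₂ (fromℚ-·-≈ 16)) (≤-reflexive (cong fromℚ (proj₂ (proj₂ (sixteenth (positive t))))))

      -- SCP needs at least two formulas ψ j.
      padded : List (PalyutinFormula (suc n))
      padded = dummy ∷ˡ dummy ∷ˡ formulas t
        where
        dummy : PalyutinFormula (suc n)
        dummy = dist (var zero) (var zero) , dist _ _

      k : ℕ
      k = List.length (formulas t)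

      p : Vector (PalyutinFormula (suc n)) (suc (suc k))
      p = List.lookup padded

      lo hi : Vector ℝ (suc (suc k))
      lo j = proj₁ (bounds (proj₁ (p j)))
      hi j = proj₁ (proj₂ (bounds (proj₁ (p j))))

      opaque
        grid : ∃ λ (gs : List (Vector ℝ (suc (suc k)))) → ∀ w → InBox lo hi w →
               ∃ λ (g : Vector ℝ (suc (suc k))) → g ∈ˡ gs × (∀ j → Within (fromℚ (4 · η)) (g j) (w j))
        grid = box-cover lo hi (λ _ → 4 · η) (λ _ → ·-pos 3 0<η)

      translate : ℝ → PalyutinFormula (suc n) → PalyutinFormula (suc n)
      translate r (φ , Pφ) = translateᶜ r $ φ , mono (translateᶜ r) (translateᶜ-nondecreasing r) Pφ

      module _ (g : Vector ℝ (suc (suc k))) where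

        uppers lowers : Vector (PalyutinFormula (suc n)) (suc (suc k))
        -- The shift `8` is the grid error `4` plus the margin `4` demanded by `Transfer`; for
        -- `lowers` the grid error alone is compensated.
        uppers j = translate (- (g j + [ 8 ])) (p j)
        lowers j = translate ([ 4 ] + (- g j)) (p j)

        open Transfer (proj₂ (maxₚ uppers)) (λ j → proj₂ (lowers j)) public

        χₚ : Vector (PalyutinFormula n) (suc (suc k))
        χₚ j = χ j , χ-palyutin j

        grid-formulas : List (PalyutinFormula n)
        grid-formulas = (Inf (proj₁ (maxₚ uppers)) , Inf (proj₂ (maxₚ uppers))) ∷ˡ
                        List.tabulate χₚ

      -- All grid points contribute, because the one close to `v` depends on the point `x` to be
      -- matched, which the test must not.
      test : Test n
      test = record
        { formulas  = List.concat (List.map grid-formulas (proj₁ grid))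
        ; tolerance = η
        ; positive  = 0<η
        }

      module _ {M N : Structure L} (N⊨SCP : N ⊨ SCP L)
        (a : Vector (Carrier M) n) (b : Vector (Carrier N) n) (close : Close test M N a b) (x : Carrier M) where

        v : Vector ℝ (suc (suc k))
        v j = ⟦ M ⟧ (proj₁ (p j)) (x ∷ a)

        opaque
          grid-point : ∃ λ (g : Vector ℝ (suc (suc k))) → g ∈ˡ proj₁ grid × (∀ j → Within (fromℚ (4 · η)) (g j) (v j))
          grid-point = proj₂ grid v λ j → proj₂ (proj₂ (bounds (proj₁ (p j)))) M (x ∷ a)

        g : Vector ℝ (suc (suc k))
        g = proj₁ grid-point
        g∈grid : g ∈ˡ proj₁ grid
        g∈grid = proj₁ (proj₂ grid-point)
        g≤v+4 : ∀ j → g j ≤ v j + [ 4 ]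
        g≤v+4 j = proj₁ (Within-weaken (proj₁ (fromℚ-·-≈ 4)) (proj₂ (proj₂ grid-point) j))
        v≤g+4 : ∀ j → v j ≤ g j + [ 4 ]
        v≤g+4 j = proj₂ (Within-weaken (proj₁ (fromℚ-·-≈ 4)) (proj₂ (proj₂ grid-point) j))

        grid-close : ∀ {φ} → φ ∈ˡ grid-formulas g →
          Within e (⟦ M ⟧ (proj₁ φ) a) (⟦ N ⟧ (proj₁ φ) b)
        grid-close {φ} φ∈ = close {φ} (∈-concat⁺′ {vs = grid-formulas g} {xss = List.map grid-formulas (proj₁ grid)}
          φ∈ (∈-map⁺ grid-formulas {x = g} {xs = proj₁ grid} g∈grid))

        upper≤ : ⟦ M ⟧ (proj₁ (maxₚ (uppers g))) (x ∷ a) + [ 4 ] ≤ 0ᵣ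
        upper≤ = ≤-⇒+-≤ (maxₚ-≤ M (x ∷ a) (uppers g) λ j → +-≤⇒≤- (≤-trans (swap _ _ _)
          (≤-+⇒-≤ (≤-trans (+-[] 4 4 (v≤g+4 j)) (≤-trans (≤+ _ ≤-refl) (+-comm _ _))))))
          where
          swap : ∀ x y z → (x + y) + z ≤ (x + z) + y
          swap x y z = ≤-trans (+-assoc _ _ _) (≤-trans (+-mono ≤-refl (+-comm _ _)) (+-assoc⁻ _ _ _))

        0≤lower : ∀ j → 0ᵣ ≤ ⟦ M ⟧ (proj₁ (lowers g j)) (x ∷ a)
        0≤lower j = ≤-trans (+-≤⇒≤- (≤-trans (+-identityˡ-≤ _) (g≤v+4 j))) (+-assoc _ _ _)

        opaque
          transferred : ∃ λ y → ⟦ N ⟧ (proj₁ (maxₚ (uppers g))) (y ∷ b) ≤ [ 3 ] ×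
                        (∀ j → 0ᵣ ≤ [ 3 ] + ⟦ N ⟧ (proj₁ (lowers g j)) (y ∷ b))
          transferred = transfer g N⊨SCP a b 0<η (grid-close {Inf (proj₁ (maxₚ (uppers g))) , Inf (proj₂ (maxₚ (uppers g)))} (here refl))
            (λ j → grid-close {χₚ g j} (there (∈-tabulate⁺ {f = χₚ g} j))) x upper≤ 0≤lower

        y : Carrier N
        y = proj₁ transferred

        module _ (j : Fin (suc (suc k))) where

          w : ℝ
          w = ⟦ N ⟧ (proj₁ (p j)) (y ∷ b)

          -- The error is `3` from `transferred`, `8` from the shift in `uppers` and `4` from the
          -- grid.
          w≤v+15 : w ≤ v j + [ 15 ]
          w≤v+15 = ≤-trans
            (-≤⇒≤-+ (≤-trans (≤-maxₚ N (y ∷ b) (uppers g) j) (proj₁ (proj₂ transferred))))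
            (≤-trans (+-comm _ _) (+-[] 12 3 (+-[] 4 8 (g≤v+4 j))))

          -- The error is `3` from `transferred` and `4` from the shift in `lowers`; the grid then
          -- makes it `11` for `v j`.
          g≤w+7 : g j ≤ w + [ 7 ]
          g≤w+7 = ≤-trans (≤-trans (≤+ _ ≤-refl) (+-comm _ _)) (≤-trans (≤-⇒+-≤ (≤-trans
            (proj₂ (proj₂ transferred) j) (≤-trans (+-mono ≤-refl (+-assoc⁻ _ _ _)) (+-assoc⁻ _ _ _))))
            (≤-trans (+-comm _ _) (+-[] 4 3 ≤-refl)))

          v-near-w : Within (fromℚ (tolerance t)) (v j) w
          v-near-w =
            ≤-trans (trans-[] 4 7 (v≤g+4 j) g≤w+7) (+-mono ≤-refl (≤-trans ([]-mono 11 5) [16]≤)) ,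
            ≤-trans w≤v+15 (+-mono ≤-refl (≤-trans ([]-mono 15 1) [16]≤))

        extension : Close t M N (x ∷ a) (y ∷ b)
        extension {φ} φ∈ = subst
          (λ φ → Within (fromℚ (tolerance t)) (⟦ M ⟧ (proj₁ φ) (x ∷ a)) (⟦ N ⟧ (proj₁ φ) (y ∷ b)))
          -- The index is raised by two to skip the dummies at the head of `padded`.
          (sym (lookup-index φ∈)) (v-near-w (suc (suc (Any.index φ∈))))

    opaque
      -- The near minimizer lives in `N`, so the extension runs from `N` back to `M`; for `Sup` it
      -- runs from `M` to `N`.
      Inf-determined : ∀ {n} (θ : Formula L (suc n)) → Determined θ → Determined (Inf θ)
      Inf-determined θ det 0<ε =
        let (δ , 0<δ , 2δ≤ε) = halve 0<ε
            (t , θ≤) = det 0<δ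
        in Extension.test t , λ {M} {N} M⊨ N⊨ a b close →
          let (y , θy≤) = Inf-approx N θ b 0<δ
              x = Extension.y t {N} {M} M⊨ b a (Close-sym (Extension.test t) close) y
              close⁺ = Extension.extension t {N} {M} M⊨ b a (Close-sym (Extension.test t) close) y
          in ≤-trans (Inf-≤ M θ a x)
               (≤-halves 2δ≤ε (θ≤ M⊨ N⊨ (x ∷ a) (y ∷ b) (Close-sym t close⁺)) θy≤)

    opaque
      Sup-determined : ∀ {n} (θ : Formula L (suc n)) → Determined θ → Determined (Sup θ)
      Sup-determined θ det 0<ε =
        let (t , θ≤) = det 0<ε
        in Extension.test t , λ {M} {N} M⊨ N⊨ a b close → Sup-≤ M θ a λ x →
          let y = Extension.y t {M} {N} N⊨ a b close x
              close⁺ = Extension.extension t {M} {N} N⊨ a b close x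
          in ≤-trans (θ≤ M⊨ N⊨ (x ∷ a) (y ∷ b) close⁺) (+-mono (≤-Sup N θ b y) ≤-refl)

    determined : ∀ {n} (θ : Formula L n) → Determined θ
    determined (dist s t)  = palyutin-determined (dist s t)
    determined (atom p ts) = palyutin-determined (atom p ts)
    determined (conn C θs) = conn-determined C θs λ j → determined (θs j)
    determined (Inf θ)     = Inf-determined θ (determined θ)
    determined (Sup θ)     = Sup-determined θ (determined θ)

-- The three implications between SCP and preservation.

module Preservation (em : ∀ {ℓ} → ExcludedMiddle ℓ) (ext : ∀ {a b} → Extensionality a b) where

  open Classical em
  open ℝ-Lemmas
  open RealArithmetic em
  open FormulaLemmas em ext
  open PalyutinProducts em ext
  open ProductAmalgamation em ext
  open Determination em ext

  module _ {ℓ} {L : Signature ℓ} where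

    -- Here and below a variable F equal to Fréchet ℓ and the qualified names only keep
    -- typechecking from unfolding the reduced product.
    Fréchet-product⊨SCP : ∀ (M : Lift ℓ ℕ → Structure L) F → F ≡ Classical.Fréchet em ℓ →
                          reducedProduct M F ⊨ SCP L
    Fréchet-product⊨SCP M F eq = amalgamates⇒⊨SCP (amalgamates-cofinite M F (tail∈ F eq) (cofinite F eq))
      where
      tail∈ : ∀ F → F ≡ Classical.Fréchet em ℓ → ∀ N → (λ i → Lift ℓ (N ℕ.≤ Lift.lower i)) ∈ sets F
      tail∈ F refl N = N , λ i N≤i → lift N≤i
      cofinite : ∀ F → F ≡ Classical.Fréchet em ℓ →
                 ∀ {J} → J ∈ sets F → ∃ λ N → ∀ i → N ℕ.≤ i → lift i ∈ J
      cofinite F refl J∈F = J∈F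

    reducedProduct⊨SCP : ∀ {I : Set ℓ} (M : I → Structure L) (F : Filter I) →
      (λ i → M i ⊨ SCP L) ∈ sets F → reducedProduct M F ⊨ SCP L
    reducedProduct⊨SCP M F M⊨SCP = amalgamates⇒⊨SCP (amalgamates-product M F M⊨SCP)

    -- The value in the product is a limit superior of a family that is constant on a filter set;
    -- properness supplies the index for the lower bound.
    palyutin-sentence-≈ : ∀ {I : Set ℓ} (M : I → Structure L) (F : Filter I) {N : Structure L} {φ : Sentence L} →
      Palyutin φ → (λ i → Lift ℓ (⟦ N ⟧ φ [] ≈ ⟦ M i ⟧ φ [])) ∈ sets F →
      ⟦ N ⟧ φ [] ≈ ⟦ reducedProduct M F ⟧ φ []
    palyutin-sentence-≈ M F {N} {φ} Pφ same =
      ≤-limit F lim (λ J∈F →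
        let (i , i∈J , lift (N≤M , _)) = Filter.proper F (Filter.meet F J∈F same) in i , i∈J , N≤M) ,
      limit-≤ F lim same λ i (lift (_ , M≤N)) → M≤N
      where
      lim : IsLimsup F (λ i → ⟦ M i ⟧ φ []) (⟦ reducedProduct M F ⟧ φ [])
      lim = subst (λ u → IsLimsup F u (⟦ reducedProduct M F ⟧ φ []))
        (ext λ i → cong (⟦ M i ⟧ φ) ([]-η (at M F [] i))) (palyutin-continuous M F Pφ [])

    palyutin-equivalent⇒≤ : ∀ {M N : Structure L} → M ⊨ SCP L → N ⊨ SCP L →
      (∀ {φ : Sentence L} → Palyutin φ → ⟦ M ⟧ φ [] ≈ ⟦ N ⟧ φ []) →
      ∀ (θ : Sentence L) → ⟦ M ⟧ θ [] ≤ ⟦ N ⟧ θ []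
    palyutin-equivalent⇒≤ M⊨SCP N⊨SCP same θ = ≤-approx λ 0<ε →
      let (t , θ≤) = determined θ 0<ε
      in θ≤ M⊨SCP N⊨SCP [] [] λ {φ} _ → ≈⇒Within (Test.positive t) (same (proj₂ φ))

    module _ (T : Theory L) where

      reduced⇒Fréchet : PreservedUnderReducedProducts T → PreservedUnderFréchetProducts T
      reduced⇒Fréchet preserved M M⊨T = preserved M (Fréchet ℓ)
        (0 , λ i _ {φ} {r} → M⊨T (lift i) {φ} {r})

      Fréchet-product⊨T : PreservedUnderFréchetProducts T → ∀ (M : Lift ℓ ℕ → Structure L) →
        (∀ i → M i ⊨ T) → ∀ F → F ≡ Classical.Fréchet em ℓ →
        Classical._⊨_ em (Classical.reducedProduct em M F) T
      Fréchet-product⊨T preserved M M⊨T F refl = preserved M M⊨T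

      -- The Fréchet power of `M` satisfies SCP outright and is a model of `T` by preservation;
      -- completeness carries the values of the SCP sentences back to `M`.
      Fréchet⇒SCP : Complete T → PreservedUnderFréchetProducts T → T ⊨ᵀ SCP L
      Fréchet⇒SCP (_ , same) preserved M M⊨T = via (Classical.Fréchet em ℓ) refl
        where
        via : ∀ F → F ≡ Classical.Fréchet em ℓ → M ⊨ SCP L
        via F eq {φ} {r} φ≤r = ≤-trans
          (proj₁ (same M (reducedProduct (λ _ → M) F) M⊨T
            (Fréchet-product⊨T preserved (λ _ → M) (λ _ → M⊨T) F eq) φ))
          (Fréchet-product⊨SCP (λ _ → M) F eq {φ} {r} φ≤r)

      -- Consistency provides a model `N` for comparison. Completeness matches it with the factors,
      -- hence with the product on Palyutin sentences; since both satisfy SCP, the conditions of `T`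
      -- follow.
      SCP⇒reduced : Complete T → T ⊨ᵀ SCP L → PreservedUnderReducedProducts T
      SCP⇒reduced ((N , N⊨T) , same) T⊨SCP M F M⊨T {φ} φ≤r =
        ≤-trans (palyutin-equivalent⇒≤ (reducedProduct⊨SCP M F M⊨SCP) (T⊨SCP N N⊨T) palyutin-same φ) (N⊨T φ≤r)
        where
        M⊨SCP : (λ i → M i ⊨ SCP L) ∈ sets F
        M⊨SCP = Filter.upward F {λ i → M i ⊨ T} {λ i → M i ⊨ SCP L} (λ {i} → T⊨SCP (M i)) M⊨T
        palyutin-same : ∀ {ψ : Sentence L} → Palyutin ψ → ⟦ reducedProduct M F ⟧ ψ [] ≈ ⟦ N ⟧ ψ []
        palyutin-same {ψ} Pψ =
          let (a , b) = palyutin-sentence-≈ M F {N} Pψ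
                (Filter.upward F {λ i → M i ⊨ T} (λ {i} Mi⊨T → lift (same N (M i) N⊨T Mi⊨T ψ)) M⊨T)
          in b , a

theorem3p13 : (em : ∀ {ℓ} → ExcludedMiddle ℓ) →
    (∀ {a b} → Extensionality a b) →
    let open Classical em in
    ∀ {ℓ} (L : Signature ℓ) (T : Theory L) → Complete T →
    (T ⊨ᵀ SCP L ⇔ PreservedUnderReducedProducts T) ×
    (PreservedUnderReducedProducts T ⇔ PreservedUnderFréchetProducts T)
theorem3p13 em ext L T complete =
    -- Both equivalences come from the cycle of `reduced⇒Fréchet`, `Fréchet⇒SCP` and `SCP⇒reduced`.
    mk⇔ (SCP⇒reduced T complete) (Fréchet⇒SCP T complete ∘ reduced⇒Fréchet T)
  , mk⇔ (reduced⇒Fréchet T) (SCP⇒reduced T complete ∘ Fréchet⇒SCP T complete)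
  where open Preservation em ext
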